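{- Let $\varepsilon\in(0,1)$ and let $T\sim T\left(n,\frac{1-\varepsilon}{n}\right)$. Then there are constants $c_\varepsilon, c'_\varepsilon>0$ depending only on $\varepsilon$ such that for all sufficiently large $n$, $$c_\varepsilon \le \Pr[\chi(T)\le 2]\le 1-c'_\varepsilon.$$
   Context: For $p\in[0,1]$, the $p$-random tournament $T\sim T(n,p)$ on vertex set $[n]$ is obtained by orienting, independently for every $1\le i<j\le n$, the edge $\{i,j\}$ as $\overrightarrow{ji}$ with probability $p$ and as $\overrightarrow{ij}$ with probability $1-p$. A tournament is $k$-colorable if its vertices can be colored with $k$ colors so that each color class induces a transitive subtournament; $\chi(T)$ is the minimum such $k$.
   Formalization: The parameter ε ranges over the rational numbers in (0,1) instead of all real numbers in (0,1). -}

module Defs where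

open import Data.Bool using (Bool; true; false; not; if_then_else_)
open import Data.Unit using (⊤; tt)
open import Data.Product using (Σ; _×_; _,_)
open import Data.Nat using (ℕ; zero; suc)
open import Data.Fin using (Fin; zero; suc)
open import Data.Maybe using (Maybe; just; nothing)
import Data.Maybe as Maybe
open import Data.Vec using (Vec; []; _∷_; lookup)
open import Data.List using (List; []; _∷_; _++_; map; concatMap)
open import Data.Integer using (+_)
open import Data.Rational using (ℚ; 0ℚ; 1ℚ; _+_; _*_; _-_; _/_)
open import Relation.Binary.PropositionalEquality using (_≡_)
open import Relation.Nullary using (Dec; yes; no)

-- A tournament on vertex set {0,…,n-1} (= Fin n, standing for [n]) is built
-- vertex by vertex: a tournament on n+1 vertices is a tournament on the
-- first n vertices together with, for every earlier vertex j < n, a bit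
-- telling whether the pair {j,n} is oriented "backwards" as n → j
-- (true, probability p) or "forwards" as j → n (false, probability 1-p).
Tour : ℕ → Set
Tour zero    = ⊤
Tour (suc n) = Tour n × Vec Bool n

last? : ∀ {n} → Fin (suc n) → Maybe (Fin n)
last? {zero}  zero    = nothing
last? {suc n} zero    = just zero
last? {suc n} (suc i) = Maybe.map suc (last? i)

arc : ∀ {n} → Tour n → Fin n → Fin n → Bool
arc {suc n} (t , v) x y with last? x | last? y
... | nothing | nothing = false
... | nothing | just j  = lookup v j
... | just i  | nothing = not (lookup v i)
... | just i  | just j  = arc t i j

Colorable : ∀ {n} → ℕ → Tour n → Set
Colorable {n} k t =
  Σ (Fin n → Fin k) λ c →
    ∀ x y z → c x ≡ c y → c y ≡ c z →
      arc t x y ≡ true → arc t y z ≡ true → arc t x z ≡ true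

χ≤ : ∀ {n} → ℕ → Tour n → Set
χ≤ k t = Colorable k t

allVecs : (n : ℕ) → List (Vec Bool n)
allVecs zero    = [] ∷ []
allVecs (suc n) = map (true ∷_) (allVecs n) ++ map (false ∷_) (allVecs n)

allTours : (n : ℕ) → List (Tour n)
allTours zero    = tt ∷ []
allTours (suc n) = concatMap (λ t → map (t ,_) (allVecs n)) (allTours n)

vweight : ∀ {n} → ℚ → Vec Bool n → ℚ
vweight p []          = 1ℚ
vweight p (b ∷ v) = (if b then p else (1ℚ - p)) * vweight p v

weight : ∀ {n} → ℚ → Tour n → ℚ
weight {zero}  p t       = 1ℚ
weight {suc n} p (t , v) = weight p t * vweight p v

sumℚ : List ℚ → ℚ
sumℚ []       = 0ℚ
sumℚ (x ∷ xs) = x + sumℚ xs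

Pr : (n : ℕ) → ℚ → (P : Tour n → Set) → (∀ t → Dec (P t)) → ℚ
Pr n p P d = sumℚ (map (λ t → ind (d t) * weight p t) (allTours n))
  where
  ind : ∀ {A : Set} → Dec A → ℚ
  ind (yes _) = 1ℚ
  ind (no _)  = 0ℚ

-- 1/n (with the irrelevant value 0 at n = 0)
inv : ℕ → ℚ
inv zero    = 0ℚ
inv (suc m) = + 1 / suc m

{-# OPTIONS --safe #-}
-- Call an arc from a later to an earlier vertex backward; the backward arcs form a sparse
-- subcritical random graph G.
--
-- Lower bound.  If G is a forest, then a proper 2-colouring of G has transitive colour
-- classes.  Reveal the vertices one at a time.  Deleting the edges of a path keeps a
-- forest a forest, so P(forest, x ~ y) is at most P(forest) times the sum over all simple
-- paths π from x to y of (p/(1-p))^|π|, which is O(1/n) as np/(1-p) stays below 1.  The next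
-- vertex closes a cycle only if it has two backward arcs into one component, so it
-- destroys the forest with conditional probability O(1/n), and (1 - O(1/n))ⁿ is bounded
-- below.
--
-- Upper bound.  Let 0, …, 8 be increasing vertices such that G contains the triangle 0 4 8
-- and 1 2 3 and 5 6 7 are cyclic triangles with the only backward arcs 3 → 1 and 7 → 5, with
-- no other relevant edges in G.  Two of 0, 4, 8 have the same colour, and the cyclic
-- triangle between them is then forced to be monochromatic in the other colour.  Letting
-- five of the nine vertices vary gives n⁵ candidates with five edges each, so the number X
-- of copies has E[X] and E[X²] of constant order, and P(X > 0) is bounded below by the
-- second moment method.
module Submission where

open import Defs
open import Level using (0ℓ)
open import Algebra.Bundles using (CommutativeRing)
open import Data.Bool using (Bool; true; false; not; _xor_; if_then_else_)
open import Data.Bool.Properties using (¬-not; not-involutive)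
import Data.Bool.Properties as Bool
open import Data.Empty using (⊥)
import Data.Fin as Fin
open import Data.Fin using (Fin; zero; suc; toℕ; inject₁; inject≤; combine)
open import Data.Fin.Patterns using (0F; 1F; 2F; 3F; 4F; 5F; 6F; 7F; 8F)
open import Data.Fin.Properties using (_≟_; all?; any?; toℕ-injective; toℕ≤pred[n]; inject≤-injective; toℕ-inject≤; combine-injective; combine-monoˡ-<)
open import Data.Fin.Subset using (Subset; _∈_; _∉_; _⊆_; ∣_∣) renaming (⊤ to full; _-_ to infixl 6 _∖_)
open import Data.Fin.Subset.Properties using (_∈?_; ∈⊤; ∣⊤∣≡n; x∈p∧x≢y⇒x∈p-y; p─q⊆p; p─x─y≡p─y─x; x∈p⇒∣p-x∣<∣p∣)
import Data.Integer as ℤ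
import Data.Integer.Properties as ℤ
open import Data.List using (List; []; _∷_; _++_; map; concatMap)
open import Data.List.Properties using (map-++; map-∘)
open import Data.List.Relation.Unary.All as All using (All; []; _∷_)
open import Data.List.Relation.Unary.AllPairs as AllPairs using (AllPairs; []; _∷_)
open import Data.Maybe using (Maybe; just; nothing)
open import Data.Nat using (ℕ; zero; suc)
import Data.Nat as ℕ
import Data.Nat.DivMod as ℕ
import Data.Nat.Properties as ℕ
open import Data.Nat.Tactic.RingSolver using () renaming (solve-∀ to ℕ-solve-∀)
open import Data.Product using (Σ; ∃; _×_; _,_; proj₁; proj₂)
open import Data.Rational using (ℚ; mkℚ; 0ℚ; 1ℚ; ½; _+_; _*_; _-_; -_; _≤_; _<_; toℚᵘ; nonNegative; positive)
import Data.Rational as ℚ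
open import Data.Rational.Properties hiding (_≟_)
import Data.Rational.Properties as ℚ
import Data.Rational.Unnormalised as ℚᵘ
import Data.Rational.Unnormalised.Properties as ℚᵘ
open import Data.Sum using (_⊎_; inj₁; inj₂)
open import Data.Unit using (⊤; tt)
open import Data.Vec using (Vec; []; _∷_; lookup; _[_]≔_; there)
open import Data.Vec.Properties using (lookup∘update; lookup∘update′)
open import Function using (_∘_; id)
open import Relation.Binary.Definitions using (tri<; tri≈; tri>)
open import Relation.Binary.PropositionalEquality
open import Relation.Nullary using (Dec; yes; no; does; ¬_; contradiction)
open import Relation.Nullary.Decidable using (dec⇒maybe; from-yes; _×-dec_; _⊎-dec_; _→-dec_; ¬?)
open import Tactic.RingSolver using (solve-∀)
open import Tactic.RingSolver.Core.AlmostCommutativeRing using (AlmostCommutativeRing; fromCommutativeRing)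
open import Algebra.Properties.Semiring.Exp (CommutativeRing.semiring +-*-commutativeRing) using (_^_; ^-assocʳ)
open import Algebra.Properties.Semiring.Sum (CommutativeRing.semiring +-*-commutativeRing)

-- Rational arithmetic and finite sums

ℚ-ring : AlmostCommutativeRing 0ℓ 0ℓ
ℚ-ring = fromCommutativeRing +-*-commutativeRing (λ x → dec⇒maybe (0ℚ ℚ.≟ x))

0≤1 : 0ℚ ≤ 1ℚ
0≤1 = ≤ᵇ⇒≤ _

≤-by : ∀ {a b} d → b ≡ a + d → 0ℚ ≤ d → a ≤ b
≤-by {a} d refl 0≤d = subst (_≤ a + d) (+-identityʳ a) (+-monoʳ-≤ a 0≤d)

0≤q-p : ∀ {p q} → p ≤ q → 0ℚ ≤ q - p
0≤q-p {p} {q} p≤q = subst (_≤ q - p) (+-inverseʳ p) (+-monoˡ-≤ (- p) p≤q)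

+-nonNeg : ∀ {a b} → 0ℚ ≤ a → 0ℚ ≤ b → 0ℚ ≤ a + b
+-nonNeg = +-mono-≤

*-monoˡ-≤ : ∀ {c a b} → 0ℚ ≤ c → a ≤ b → c * a ≤ c * b
*-monoˡ-≤ {c} 0≤c = *-monoˡ-≤-nonNeg c {{nonNegative 0≤c}}

*-monoʳ-≤ : ∀ {c a b} → 0ℚ ≤ c → a ≤ b → a * c ≤ b * c
*-monoʳ-≤ {c} 0≤c = *-monoʳ-≤-nonNeg c {{nonNegative 0≤c}}

*-nonNeg : ∀ {a b} → 0ℚ ≤ a → 0ℚ ≤ b → 0ℚ ≤ a * b
*-nonNeg {a} {b} 0≤a 0≤b = subst (_≤ a * b) (*-zeroʳ a) (*-monoˡ-≤ 0≤a 0≤b)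

*-mono-≤ : ∀ {a b c d} → 0ℚ ≤ a → a ≤ b → 0ℚ ≤ c → c ≤ d → a * c ≤ b * d
*-mono-≤ 0≤a a≤b 0≤c c≤d =
  ≤-trans (*-monoˡ-≤ 0≤a c≤d) (*-monoʳ-≤ (≤-trans 0≤c c≤d) a≤b)

*-pos : ∀ {a b} → 0ℚ < a → 0ℚ < b → 0ℚ < a * b
*-pos {a} {b} 0<a 0<b =
  positive⁻¹ (a * b) {{pos*pos⇒pos a {{positive 0<a}} b {{positive 0<b}}}}

val : Bool → ℚ
val true  = 1ℚ
val false = 0ℚ

⟦_⟧ : ∀ {A : Set} → Dec A → ℚ
⟦ d ⟧ = val (does d)

val-nonNeg : ∀ b → 0ℚ ≤ val b
val-nonNeg true  = 0≤1
val-nonNeg false = ≤-refl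

val≤1 : ∀ b → val b ≤ 1ℚ
val≤1 true  = ≤-refl
val≤1 false = 0≤1

⟦⟧-mono : ∀ {A B : Set} (a : Dec A) (b : Dec B) → (A → B) → ⟦ a ⟧ ≤ ⟦ b ⟧
⟦⟧-mono (no _)  b       _ = val-nonNeg (does b)
⟦⟧-mono (yes _) (yes _) _ = ≤-refl
⟦⟧-mono (yes x) (no ¬b) f = contradiction (f x) ¬b

sum-mono : ∀ {n} {f g : Fin n → ℚ} → (∀ i → f i ≤ g i) → sum f ≤ sum g
sum-mono {zero}  h = ≤-refl
sum-mono {suc n} h = +-mono-≤ (h zero) (sum-mono (h ∘ suc))

sum-nonNeg : ∀ {n} {f : Fin n → ℚ} → (∀ i → 0ℚ ≤ f i) → 0ℚ ≤ sum f
sum-nonNeg {zero}  h = ≤-refl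
sum-nonNeg {suc n} h = +-nonNeg (h zero) (sum-nonNeg (h ∘ suc))

term≤sum : ∀ {n} {f : Fin n → ℚ} → (∀ i → 0ℚ ≤ f i) → ∀ i → f i ≤ sum f
term≤sum {f = f} h zero    = ≤-by _ refl (sum-nonNeg (h ∘ suc))
term≤sum {f = f} h (suc i) = ≤-trans (term≤sum (h ∘ suc) i) (≤-by _ (+-comm (f zero) _) (h zero))

fromℕ : ℕ → ℚ
fromℕ zero    = 0ℚ
fromℕ (suc n) = 1ℚ + fromℕ n

fromℕ-nonNeg : ∀ n → 0ℚ ≤ fromℕ n
fromℕ-nonNeg zero    = ≤-refl
fromℕ-nonNeg (suc n) = +-nonNeg 0≤1 (fromℕ-nonNeg n)

fromℕ-mono-≤ : ∀ {m n} → m ℕ.≤ n → fromℕ m ≤ fromℕ n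
fromℕ-mono-≤ {n = n} ℕ.z≤n = fromℕ-nonNeg n
fromℕ-mono-≤ (ℕ.s≤s m≤n) = +-monoʳ-≤ 1ℚ (fromℕ-mono-≤ m≤n)

fromℕ-+ : ∀ m n → fromℕ (m ℕ.+ n) ≡ fromℕ m + fromℕ n
fromℕ-+ zero    n = sym (+-identityˡ (fromℕ n))
fromℕ-+ (suc m) n = trans (cong (1ℚ +_) (fromℕ-+ m n)) (sym (+-assoc 1ℚ (fromℕ m) (fromℕ n)))

fromℕ-* : ∀ m n → fromℕ (m ℕ.* n) ≡ fromℕ m * fromℕ n
fromℕ-* zero    n = sym (*-zeroˡ (fromℕ n))
fromℕ-* (suc m) n = trans (fromℕ-+ n (m ℕ.* n))
  (trans (cong (fromℕ n +_) (fromℕ-* m n)) (lemma (fromℕ m) (fromℕ n)))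
  where
  lemma : ∀ a b → b + a * b ≡ (1ℚ + a) * b
  lemma = solve-∀ ℚ-ring

toℚᵘ-fromℕ : ∀ n → toℚᵘ (fromℕ n) ℚᵘ.≃ ℚᵘ.mkℚᵘ (ℤ.+ n) 0
toℚᵘ-fromℕ zero    = ℚᵘ.≃-refl
toℚᵘ-fromℕ (suc n) = ℚᵘ.≃-trans (toℚᵘ-homo-+ 1ℚ (fromℕ n))
  (ℚᵘ.≃-trans (ℚᵘ.+-congʳ ℚᵘ.1ℚᵘ (toℚᵘ-fromℕ n)) (ℚᵘ.*≡* (trans (ℤ.*-identityʳ _)
    (trans (cong (ℤ._+_ (ℤ.+ 1)) (ℤ.*-identityʳ (ℤ.+ n))) (sym (ℤ.*-identityʳ _))))))

fromℕ*inv : ∀ n → .{{_ : ℕ.NonZero n}} → fromℕ n * inv n ≡ 1ℚ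
fromℕ*inv (suc m) = toℚᵘ-injective (ℚᵘ.≃-trans (toℚᵘ-homo-* (fromℕ (suc m)) (inv (suc m)))
  (ℚᵘ.≃-trans (ℚᵘ.*-cong (toℚᵘ-fromℕ (suc m)) (toℚᵘ-fromℚᵘ (ℚᵘ.mkℚᵘ (ℤ.+ 1) m)))
    (ℚᵘ.*-inverseʳ (ℚᵘ.mkℚᵘ (ℤ.+ suc m) 0))))

inv-nonNeg : ∀ n → 0ℚ ≤ inv n
inv-nonNeg zero    = ≤-refl
inv-nonNeg (suc m) = nonNegative⁻¹ _ {{normalize-nonNeg 1 (suc m)}}

sum-const : ∀ n c → sum {n} (λ _ → c) ≡ fromℕ n * c
sum-const zero    c = sym (*-zeroˡ c)
sum-const (suc n) c = trans (cong (c +_) (sum-const n c)) (lemma (fromℕ n) c)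
  where
  lemma : ∀ a b → b + a * b ≡ (1ℚ + a) * b
  lemma = solve-∀ ℚ-ring

-- The graph of backward arcs

-- The recursion of `arc` without its `not`: the value no longer depends on the order of the two
-- vertices and is true exactly for pairs joined by a backward arc.
adj : ∀ {n} → Tour n → Fin n → Fin n → Bool
adj {suc n} (t , v) x y with last? x | last? y
... | nothing | nothing = false
... | nothing | just j  = lookup v j
... | just i  | nothing = lookup v i
... | just i  | just j  = adj t i j

setAdj : ∀ {n} → Bool → Fin n → Fin n → Tour n → Tour n
setAdj {suc n} b x y (t , v) with last? x | last? y
... | nothing | nothing = t , v
... | nothing | just j  = t , v [ j ]≔ b
... | just i  | nothing = t , v [ i ]≔ b
... | just i  | just j  = setAdj b i j t , v

SameEdge : ∀ {n} → Fin n → Fin n → Fin n → Fin n → Set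
SameEdge x y u w = (x ≡ u × y ≡ w) ⊎ (x ≡ w × y ≡ u)

last?-injective : ∀ {n} (x y : Fin (suc n)) → last? x ≡ last? y → x ≡ y
last?-injective {zero}  zero    zero    _ = refl
last?-injective {suc n} zero    zero    _ = refl
last?-injective {suc n} zero    (suc y) e with last? y
last?-injective {suc n} zero    (suc y) () | nothing
last?-injective {suc n} zero    (suc y) () | just _
last?-injective {suc n} (suc x) zero    e with last? x
last?-injective {suc n} (suc x) zero    () | nothing
last?-injective {suc n} (suc x) zero    () | just _
last?-injective {suc n} (suc x) (suc y) e with last? x in ex | last? y in ey
last?-injective {suc n} (suc x) (suc y) refl | just i | just i = cong suc (last?-injective x y (trans ex (sym ey)))
last?-injective {suc n} (suc x) (suc y) e | nothing | nothing = cong suc (last?-injective x y (trans ex (sym ey)))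

last?-just-injective : ∀ {n} {x y : Fin (suc n)} {i j} →
  last? x ≡ just i → last? y ≡ just j → i ≡ j → x ≡ y
last?-just-injective ex ey refl = last?-injective _ _ (trans ex (sym ey))

adj-irrefl : ∀ {n} (t : Tour n) x → adj t x x ≡ false
adj-irrefl {suc n} (t , v) x with last? x
... | nothing = refl
... | just i  = adj-irrefl t i

adj-sym : ∀ {n} (t : Tour n) x y → adj t x y ≡ adj t y x
adj-sym {suc n} (t , v) x y with last? x | last? y
... | nothing | nothing = refl
... | nothing | just j  = refl
... | just i  | nothing = refl
... | just i  | just j  = adj-sym t i j

adj-setAdj : ∀ {n} b (x y : Fin n) t → x ≢ y → adj (setAdj b x y t) x y ≡ b
adj-setAdj {suc n} b x y (t , v) x≢y with last? x in ex | last? y in ey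
... | nothing | nothing = contradiction (last?-injective x y (trans ex (sym ey))) x≢y
... | nothing | just j = lookup∘update j v b
... | just i  | nothing = lookup∘update i v b
... | just i  | just j =
  adj-setAdj b i j t (λ i≡j → x≢y (last?-just-injective ex ey i≡j))

adj-setAdj-≁ : ∀ {n} b (x y : Fin n) t u w → ¬ SameEdge x y u w →
               adj (setAdj b x y t) u w ≡ adj t u w
adj-setAdj-≁ {suc n} b x y (t , v) u w ≁ with last? x in ex | last? y in ey | last? u in eu | last? w in ew
... | nothing | nothing | _       | _ = refl
... | nothing | just j  | nothing | nothing = refl
... | nothing | just j  | nothing | just l =
  lookup∘update′ (λ l≡j → ≁ (inj₁ (last?-injective x u (trans ex (sym eu)) , last?-just-injective ey ew (sym l≡j)))) v b
... | nothing | just j  | just k  | nothing =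
  lookup∘update′ (λ k≡j → ≁ (inj₂ (last?-injective x w (trans ex (sym ew)) , last?-just-injective ey eu (sym k≡j)))) v b
... | nothing | just j  | just k  | just l = refl
... | just i  | nothing | nothing | nothing = refl
... | just i  | nothing | nothing | just l =
  lookup∘update′ (λ l≡i → ≁ (inj₂ (last?-just-injective ex ew (sym l≡i) , last?-injective y u (trans ey (sym eu))))) v b
... | just i  | nothing | just k  | nothing =
  lookup∘update′ (λ k≡i → ≁ (inj₁ (last?-just-injective ex eu (sym k≡i) , last?-injective y w (trans ey (sym ew))))) v b
... | just i  | nothing | just k  | just l = refl
... | just i  | just j  | nothing | nothing = refl
... | just i  | just j  | nothing | just l = refl
... | just i  | just j  | just k  | nothing = refl
... | just i  | just j  | just k  | just l =
  adj-setAdj-≁ b i j t k l λ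
    { (inj₁ (i≡k , j≡l)) → ≁ (inj₁ (last?-just-injective ex eu i≡k , last?-just-injective ey ew j≡l))
    ; (inj₂ (i≡l , j≡k)) → ≁ (inj₂ (last?-just-injective ex ew i≡l , last?-just-injective ey eu j≡k)) }

toℕ-last?-nothing : ∀ {n} (x : Fin (suc n)) → last? x ≡ nothing → toℕ x ≡ n
toℕ-last?-nothing {zero}  zero    e = refl
toℕ-last?-nothing {suc n} (suc x) e with last? x in ex
... | nothing = cong suc (toℕ-last?-nothing x ex)

toℕ-last?-just : ∀ {n} (x : Fin (suc n)) {i} → last? x ≡ just i → toℕ x ≡ toℕ i
toℕ-last?-just {suc n} zero    refl = refl
toℕ-last?-just {suc n} (suc x) e with last? x in ex
toℕ-last?-just {suc n} (suc x) refl | just i = cong suc (toℕ-last?-just x ex)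

-- Expectation over random tournaments

sumℚ-map-cong : ∀ {A : Set} {f g : A → ℚ} xs → (∀ x → f x ≡ g x) → sumℚ (map f xs) ≡ sumℚ (map g xs)
sumℚ-map-cong []       f≗g = refl
sumℚ-map-cong (x ∷ xs) f≗g = cong₂ _+_ (f≗g x) (sumℚ-map-cong xs f≗g)

-- Matching the goal `ind (d t)` is the only way to unfold the local function
-- of `Pr`, which has no name outside of `Defs`.
mutual
  Pr-unfold : ∀ n p (P : Tour n → Set) d →
    Pr n p P d ≡ sumℚ (map (λ t → ⟦ d t ⟧ * weight p t) (allTours n))
  Pr-unfold n p P d = sumℚ-map-cong (allTours n) (Pr-unfold-term n p P d)

  Pr-unfold-term : ∀ n p (P : Tour n → Set) (d : ∀ t → Dec (P t)) t → _ ≡ ⟦ d t ⟧ * weight p t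
  Pr-unfold-term n p P d t with d t
  ... | yes _ = refl
  ... | no _  = refl

sumℚ-++ : ∀ xs ys → sumℚ (xs ++ ys) ≡ sumℚ xs + sumℚ ys
sumℚ-++ []       ys = sym (+-identityˡ (sumℚ ys))
sumℚ-++ (x ∷ xs) ys = trans (cong (x +_) (sumℚ-++ xs ys)) (sym (+-assoc x (sumℚ xs) (sumℚ ys)))

sumℚ-concatMap : ∀ {A B : Set} (h : B → ℚ) (k : A → List B) xs →
  sumℚ (map h (concatMap k xs)) ≡ sumℚ (map (λ x → sumℚ (map h (k x))) xs)
sumℚ-concatMap h k []       = refl
sumℚ-concatMap h k (x ∷ xs) = begin
  sumℚ (map h (k x ++ concatMap k xs))                  ≡⟨ cong sumℚ (map-++ h (k x) (concatMap k xs)) ⟩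
  sumℚ (map h (k x) ++ map h (concatMap k xs))          ≡⟨ sumℚ-++ (map h (k x)) _ ⟩
  sumℚ (map h (k x)) + sumℚ (map h (concatMap k xs))    ≡⟨ cong (sumℚ (map h (k x)) +_) (sumℚ-concatMap h k xs) ⟩
  sumℚ (map h (k x)) + sumℚ (map (λ x → sumℚ (map h (k x))) xs) ∎
  where open ≡-Reasoning

*-distribˡ-sumℚ : ∀ {A : Set} c (f : A → ℚ) xs → sumℚ (map (λ x → c * f x) xs) ≡ c * sumℚ (map f xs)
*-distribˡ-sumℚ c f []       = sym (*-zeroʳ c)
*-distribˡ-sumℚ c f (x ∷ xs) = trans (cong (c * f x +_) (*-distribˡ-sumℚ c f xs)) (sym (*-distribˡ-+ c (f x) _))

module Expectation (p : ℚ) (0≤p : 0ℚ ≤ p) (p≤1 : p ≤ 1ℚ) where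

  0≤1-p : 0ℚ ≤ 1ℚ - p
  0≤1-p = 0≤q-p p≤1

  -- Expectations are averages over one bit at a time, so that their laws follow by induction;
  -- `E-weight` identifies `E` with the weighted sum over `allTours` that defines `Pr`.
  EV : ∀ n → (Vec Bool n → ℚ) → ℚ
  EV zero    f = f []
  EV (suc n) f = p * EV n (f ∘ (true ∷_)) + (1ℚ - p) * EV n (f ∘ (false ∷_))

  E : ∀ n → (Tour n → ℚ) → ℚ
  E zero    f = f tt
  E (suc n) f = E n (λ t → EV n (λ v → f (t , v)))

  EV-cong : ∀ n {f g} → (∀ v → f v ≡ g v) → EV n f ≡ EV n g
  EV-cong zero    f≗g = f≗g []
  EV-cong (suc n) f≗g = cong₂ (λ a b → p * a + (1ℚ - p) * b)
    (EV-cong n (f≗g ∘ (true ∷_))) (EV-cong n (f≗g ∘ (false ∷_)))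

  E-cong : ∀ n {f g} → (∀ t → f t ≡ g t) → E n f ≡ E n g
  E-cong zero    f≗g = f≗g tt
  E-cong (suc n) f≗g = E-cong n (λ t → EV-cong n (λ v → f≗g (t , v)))

  EV-mono : ∀ n {f g} → (∀ v → f v ≤ g v) → EV n f ≤ EV n g
  EV-mono zero    f≤g = f≤g []
  EV-mono (suc n) f≤g = +-mono-≤
    (*-monoˡ-≤ 0≤p (EV-mono n (f≤g ∘ (true ∷_)))) (*-monoˡ-≤ 0≤1-p (EV-mono n (f≤g ∘ (false ∷_))))

  E-mono : ∀ n {f g} → (∀ t → f t ≤ g t) → E n f ≤ E n g
  E-mono zero    f≤g = f≤g tt
  E-mono (suc n) f≤g = E-mono n (λ t → EV-mono n (λ v → f≤g (t , v)))

  EV-linear : ∀ n a b f g → EV n (λ v → a * f v + b * g v) ≡ a * EV n f + b * EV n g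
  EV-linear zero    a b f g = refl
  EV-linear (suc n) a b f g = trans
    (cong₂ (λ x y → p * x + (1ℚ - p) * y) (EV-linear n a b _ _) (EV-linear n a b _ _))
    (rearrange p (1ℚ - p) a b _ _ _ _)
    where
    rearrange : ∀ p q a b x y z w → p * (a * x + b * y) + q * (a * z + b * w) ≡ a * (p * x + q * z) + b * (p * y + q * w)
    rearrange = solve-∀ ℚ-ring

  E-linear : ∀ n a b f g → E n (λ t → a * f t + b * g t) ≡ a * E n f + b * E n g
  E-linear zero    a b f g = refl
  E-linear (suc n) a b f g = trans (E-cong n (λ t → EV-linear n a b _ _)) (E-linear n a b _ _)

  EV-const : ∀ n c → EV n (λ _ → c) ≡ c
  EV-const zero    c = refl
  EV-const (suc n) c = trans (cong (λ x → p * x + (1ℚ - p) * x) (EV-const n c)) (lemma p c)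
    where
    lemma : ∀ p c → p * c + (1ℚ - p) * c ≡ c
    lemma = solve-∀ ℚ-ring

  E-const : ∀ n c → E n (λ _ → c) ≡ c
  E-const zero    c = refl
  E-const (suc n) c = trans (E-cong n (λ _ → EV-const n c)) (E-const n c)

  E-+ : ∀ n f g → E n (λ t → f t + g t) ≡ E n f + E n g
  E-+ n f g = begin
    E n (λ t → f t + g t)               ≡⟨ E-cong n (λ t → cong₂ _+_ (*-identityˡ (f t)) (*-identityˡ (g t))) ⟨
    E n (λ t → 1ℚ * f t + 1ℚ * g t)     ≡⟨ E-linear n 1ℚ 1ℚ f g ⟩
    1ℚ * E n f + 1ℚ * E n g             ≡⟨ cong₂ _+_ (*-identityˡ (E n f)) (*-identityˡ (E n g)) ⟩
    E n f + E n g                       ∎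
    where open ≡-Reasoning

  E-* : ∀ n a f → E n (λ t → a * f t) ≡ a * E n f
  E-* n a f = begin
    E n (λ t → a * f t)               ≡⟨ E-cong n (λ t → lemma a (f t)) ⟩
    E n (λ t → a * f t + 0ℚ * f t)    ≡⟨ E-linear n a 0ℚ f f ⟩
    a * E n f + 0ℚ * E n f            ≡⟨ lemma a (E n f) ⟨
    a * E n f                         ∎
    where
    open ≡-Reasoning
    lemma : ∀ a x → a * x ≡ a * x + 0ℚ * x
    lemma = solve-∀ ℚ-ring

  E-sum : ∀ n {k} (f : Fin k → Tour n → ℚ) → E n (λ t → sum (λ i → f i t)) ≡ sum (λ i → E n (f i))
  E-sum n {zero}  f = E-const n 0ℚ
  E-sum n {suc k} f = trans (E-+ n (f zero) _) (cong (E n (f zero) +_) (E-sum n (f ∘ suc)))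

  E-nonNeg : ∀ n {f} → (∀ t → 0ℚ ≤ f t) → 0ℚ ≤ E n f
  E-nonNeg n {f} 0≤f = subst (_≤ E n f) (E-const n 0ℚ) (E-mono n 0≤f)

  EV-weight : ∀ n f → sumℚ (map (λ v → f v * vweight p v) (allVecs n)) ≡ EV n f
  EV-weight zero    f = trans (+-identityʳ _) (*-identityʳ (f []))
  EV-weight (suc n) f = begin
    sumℚ (map h (map (true ∷_) vs ++ map (false ∷_) vs))
      ≡⟨ cong sumℚ (map-++ h (map (true ∷_) vs) _) ⟩
    sumℚ (map h (map (true ∷_) vs) ++ map h (map (false ∷_) vs))
      ≡⟨ sumℚ-++ (map h (map (true ∷_) vs)) _ ⟩
    sumℚ (map h (map (true ∷_) vs)) + sumℚ (map h (map (false ∷_) vs))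
      ≡⟨ cong₂ _+_ (half true) (half false) ⟩
    EV (suc n) f ∎
    where
    open ≡-Reasoning
    vs = allVecs n
    h : Vec Bool (suc n) → ℚ
    h v = f v * vweight p v
    swap : ∀ a b c → a * (b * c) ≡ b * (a * c)
    swap = solve-∀ ℚ-ring
    half : ∀ b → sumℚ (map h (map (b ∷_) vs)) ≡ (if b then p else (1ℚ - p)) * EV n (f ∘ (b ∷_))
    half b = begin
      sumℚ (map h (map (b ∷_) vs))                              ≡⟨ cong sumℚ (map-∘ vs) ⟨
      sumℚ (map (λ v → f (b ∷ v) * (q * vweight p v)) vs)       ≡⟨ sumℚ-map-cong vs (λ v → swap (f (b ∷ v)) q (vweight p v)) ⟩
      sumℚ (map (λ v → q * (f (b ∷ v) * vweight p v)) vs)       ≡⟨ *-distribˡ-sumℚ q _ vs ⟩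
      q * sumℚ (map (λ v → f (b ∷ v) * vweight p v) vs)         ≡⟨ cong (q *_) (EV-weight n (f ∘ (b ∷_))) ⟩
      q * EV n (f ∘ (b ∷_))                                     ∎
      where q = if b then p else (1ℚ - p)

  E-weight : ∀ n f → sumℚ (map (λ t → f t * weight p t) (allTours n)) ≡ E n f
  E-weight zero    f = trans (+-identityʳ _) (*-identityʳ (f tt))
  E-weight (suc n) f = begin
    sumℚ (map h (concatMap (λ t → map (t ,_) (allVecs n)) (allTours n)))
      ≡⟨ sumℚ-concatMap h _ (allTours n) ⟩
    sumℚ (map (λ t → sumℚ (map h (map (t ,_) (allVecs n)))) (allTours n))
      ≡⟨ sumℚ-map-cong (allTours n) inner ⟩
    sumℚ (map (λ t → EV n (λ v → f (t , v)) * weight p t) (allTours n))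
      ≡⟨ E-weight n _ ⟩
    E (suc n) f ∎
    where
    open ≡-Reasoning
    h : Tour (suc n) → ℚ
    h t = f t * weight p t
    swap : ∀ a b c → a * (b * c) ≡ b * (a * c)
    swap = solve-∀ ℚ-ring
    inner : ∀ t → sumℚ (map h (map (t ,_) (allVecs n))) ≡ EV n (λ v → f (t , v)) * weight p t
    inner t = begin
      sumℚ (map h (map (t ,_) (allVecs n)))
        ≡⟨ cong sumℚ (map-∘ (allVecs n)) ⟨
      sumℚ (map (λ v → f (t , v) * (weight p t * vweight p v)) (allVecs n))
        ≡⟨ sumℚ-map-cong (allVecs n) (λ v → swap (f (t , v)) (weight p t) (vweight p v)) ⟩
      sumℚ (map (λ v → weight p t * (f (t , v) * vweight p v)) (allVecs n))
        ≡⟨ *-distribˡ-sumℚ (weight p t) _ (allVecs n) ⟩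
      weight p t * sumℚ (map (λ v → f (t , v) * vweight p v) (allVecs n))
        ≡⟨ cong (weight p t *_) (EV-weight n _) ⟩
      weight p t * EV n (λ v → f (t , v))
        ≡⟨ *-comm (weight p t) _ ⟩
      EV n (λ v → f (t , v)) * weight p t ∎

  Pr≡E : ∀ n (P : Tour n → Set) d → Pr n p P d ≡ E n (λ t → ⟦ d t ⟧)
  Pr≡E n P d = trans (Pr-unfold n p P d) (E-weight n (λ t → ⟦ d t ⟧))

  EV-resample : ∀ n i f →
    EV n f ≡ p * EV n (λ v → f (v [ i ]≔ true)) + (1ℚ - p) * EV n (λ v → f (v [ i ]≔ false))
  EV-resample (suc n) zero    f = lemma p _ _
    where
    lemma : ∀ p x y → p * x + (1ℚ - p) * y ≡
      p * (p * x + (1ℚ - p) * x) + (1ℚ - p) * (p * y + (1ℚ - p) * y)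
    lemma = solve-∀ ℚ-ring
  EV-resample (suc n) (suc i) f = trans
    (cong₂ (λ x y → p * x + (1ℚ - p) * y) (EV-resample n i _) (EV-resample n i _))
    (lemma p (1ℚ - p) _ _ _ _)
    where
    lemma : ∀ p q x y z w → p * (p * x + q * y) + q * (p * z + q * w) ≡ p * (p * x + q * z) + q * (p * y + q * w)
    lemma = solve-∀ ℚ-ring

  -- Overwriting one edge with a fresh copy of it preserves the distribution. Independence of the
  -- edges is used in this form: conditioning on an edge becomes composition with `setAdj`.
  E-resample : ∀ n {x y} → x ≢ y → ∀ f →
    E n f ≡ p * E n (f ∘ setAdj true x y) + (1ℚ - p) * E n (f ∘ setAdj false x y)
  E-resample (suc n) {x} {y} x≢y f with last? x in ex | last? y in ey
  ... | nothing | nothing = contradiction (last?-injective x y (trans ex (sym ey))) x≢y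
  ... | nothing | just j  = trans (E-cong n (λ t → EV-resample n j _)) (E-linear n p (1ℚ - p) _ _)
  ... | just i  | nothing = trans (E-cong n (λ t → EV-resample n i _)) (E-linear n p (1ℚ - p) _ _)
  ... | just i  | just j  = E-resample n (λ i≡j → x≢y (last?-just-injective ex ey i≡j)) _

-- Paths, forests and colourings

-- k bounds the number of vertices of the path, all of which lie in A.
Path : ∀ {n} → (Fin n → Fin n → Bool) → ℕ → Subset n → Fin n → Fin n → Set
Path g zero    A x y = ⊥
Path g (suc k) A x y = x ∈ A × (x ≡ y ⊎ ∃ λ z → g x z ≡ true × Path g k (A ∖ x) z y)

Path? : ∀ {n} (g : Fin n → Fin n → Bool) k A x y → Dec (Path g k A x y)
Path? g zero    A x y = no λ ()
Path? g (suc k) A x y = (x ∈? A) ×-dec ((x ≟ y) ⊎-dec any? λ z → (g x z Bool.≟ true) ×-dec Path? g k (A ∖ x) z y)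


x∉A∖x : ∀ {n} (A : Subset n) x → x ∉ A ∖ x
x∉A∖x (true  ∷ A) zero    ()
x∉A∖x (false ∷ A) zero    ()
x∉A∖x (_     ∷ A) (suc x) (there h) = x∉A∖x A x h

∖-mono : ∀ {n} {A B : Subset n} x → A ⊆ B → A ∖ x ⊆ B ∖ x
∖-mono {A = A} x A⊆B {z} h =
  x∈p∧x≢y⇒x∈p-y (A⊆B (p─q⊆p A _ h)) λ { refl → x∉A∖x A x h }

-- All vertices of the path lie in `A`, so only edges inside `A` have to survive. This is what
-- allows an edge at a vertex outside `A` to be deleted.
Path-mono : ∀ {n} {g g′ : Fin n → Fin n → Bool} k {A B : Subset n} {x y} → A ⊆ B →
  (∀ {u w} → u ∈ A → w ∈ A → g u w ≡ true → g′ u w ≡ true) → Path g k A x y → Path g′ k B x y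
Path-mono (suc k) A⊆B g⊆g′ (x∈A , inj₁ x≡y) = A⊆B x∈A , inj₁ x≡y
Path-mono {g = g} {g′} (suc k) {A} {B} {x} {y} A⊆B g⊆g′ (x∈A , inj₂ (z , gxz , π)) =
  A⊆B x∈A , inj₂ (z , g⊆g′ x∈A (A∖x⊆A (start∈ k π)) gxz ,
    Path-mono k (∖-mono x A⊆B) (λ u∈ w∈ → g⊆g′ (A∖x⊆A u∈) (A∖x⊆A w∈)) π)
  where
  A∖x⊆A : A ∖ x ⊆ A
  A∖x⊆A = p─q⊆p A _
  start∈ : ∀ k {C z} → Path g k C z y → z ∈ C
  start∈ (suc k) π = proj₁ π

-- Each step removes a vertex from `A`, so a path never has more than `∣ A ∣` vertices.
Path-fuel : ∀ {n} {g : Fin n → Fin n → Bool} j k {A : Subset n} {x y} →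
  ∣ A ∣ ℕ.≤ k → Path g j A x y → Path g k A x y
Path-fuel (suc j) zero    ∣A∣≤k (x∈A , _) =
  contradiction (ℕ.≤-trans (ℕ.≤-trans (ℕ.s≤s ℕ.z≤n) (x∈p⇒∣p-x∣<∣p∣ x∈A)) ∣A∣≤k) λ ()
Path-fuel (suc j) (suc k) ∣A∣≤k (x∈A , inj₁ x≡y) = x∈A , inj₁ x≡y
Path-fuel (suc j) (suc k) ∣A∣≤k (x∈A , inj₂ (z , gxz , π)) =
  x∈A , inj₂ (z , gxz , Path-fuel j k (ℕ.s≤s⁻¹ (ℕ.≤-trans (x∈p⇒∣p-x∣<∣p∣ x∈A) ∣A∣≤k)) π)

-- The path is followed until it meets `y`; from there on its remainder starts at `y`. The lemma
-- keeps paths simple when a vertex is prepended.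
Path-avoid : ∀ {n} {g : Fin n → Fin n → Bool} k {A : Subset n} {x u} y →
  Path g k A x u → Path g k (A ∖ y) x u ⊎ Path g k A y u
Path-avoid {g = g} (suc k) {A} {x} {u} y π@(x∈A , tl) with x ≟ y
... | yes refl = inj₂ π
... | no x≢y with tl
...   | inj₁ x≡u = inj₁ (x∈p∧x≢y⇒x∈p-y x∈A x≢y , inj₁ x≡u)
...   | inj₂ (z , gxz , π′) with Path-avoid k y π′
...     | inj₁ π″ = inj₁ (x∈p∧x≢y⇒x∈p-y x∈A x≢y ,
            inj₂ (z , gxz , subst (λ C → Path g k C z u) (p─x─y≡p─y─x A x y) π″))
...     | inj₂ π″ = inj₂ (Path-fuel′ (Path-mono k (p─q⊆p A _) (λ _ _ e → e) π″))
  where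
  Path-fuel′ : ∀ {y k A} → Path g k A y u → Path g (suc k) A y u
  Path-fuel′ {k = suc k} (h , inj₁ e)           = h , inj₁ e
  Path-fuel′ {k = suc k} (h , inj₂ (z , e , π)) = h , inj₂ (z , e , Path-fuel′ π)

Connected : ∀ {n} → Tour n → Fin n → Fin n → Set
Connected {n} t = Path (adj t) n full

Connected? : ∀ {n} (t : Tour n) x y → Dec (Connected t x y)
Connected? {n} t = Path? (adj t) n full

∣full∣≤n : ∀ n → ∣ full {n} ∣ ℕ.≤ n
∣full∣≤n n = ℕ.≤-reflexive (∣⊤∣≡n n)

Connected-refl : ∀ {n} (t : Tour n) x → Connected t x x
Connected-refl {n} t x = Path-fuel 1 n (∣full∣≤n n) (∈⊤ , inj₁ refl)

-- If the path from `x` avoids `y`, then `y` can be prepended; otherwise the remainder of the path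
-- from its visit to `y` already does the job.
Connected-step : ∀ {n} (t : Tour n) {x y u} → adj t y x ≡ true → Connected t x u → Connected t y u
Connected-step {n} t {x} {y} yx π with Path-avoid n y π
... | inj₁ π′ = Path-fuel (suc n) n (∣full∣≤n n) (∈⊤ , inj₂ (x , yx , π′))
... | inj₂ π′ = π′

-- The graph of backward arcs has no cycle: a cycle would be closed by its last vertex.
Forest : ∀ {n} → Tour n → Set
Forest {zero}  _       = ⊤
Forest {suc n} (t , v) = Forest t ×
  (∀ i → lookup v i ≡ true → ∀ j → lookup v j ≡ true → i ≢ j → ¬ Connected t i j)

Forest? : ∀ {n} (t : Tour n) → Dec (Forest t)
Forest? {zero}  _       = yes tt
Forest? {suc n} (t , v) = Forest? t ×-dec
  all? λ i → (lookup v i Bool.≟ true) →-dec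
  all? λ j → (lookup v j Bool.≟ true) →-dec (¬? (i ≟ j) →-dec ¬? (Connected? t i j))

Proper : ∀ {n} → Tour n → (Fin n → Bool) → Set
Proper t c = ∀ x y → adj t x y ≡ true → c x ≢ c y

-- Induction on the vertices. The new vertex gets the colour `true`, and every old component
-- containing a neighbour of that colour is flipped. A component contains at most one neighbour of
-- the new vertex, so after the flips all neighbours have the colour `false`.
Forest⇒Proper : ∀ {n} (t : Tour n) → Forest t → ∃ (Proper t)
Forest⇒Proper {zero}  t       _           = (λ ()) , λ ()
Forest⇒Proper {suc n} (t , v) (forest , apart) with Forest⇒Proper t forest
... | c , c-proper = (λ x → extend (last? x)) , proper
  where
  Flip : Fin n → Set
  Flip x = ∃ λ u → (lookup v u ≡ true × c u ≡ true) × Connected t x u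

  Flip? : ∀ x → Dec (Flip x)
  Flip? x = any? λ u → ((lookup v u Bool.≟ true) ×-dec (c u Bool.≟ true)) ×-dec Connected? t x u

  c′ : Fin n → Bool
  c′ x = does (Flip? x) xor c x

  extend : Maybe (Fin n) → Bool
  extend nothing  = true
  extend (just i) = c′ i

  c′-neighbour : ∀ u → lookup v u ≡ true → c′ u ≡ false
  c′-neighbour u vu with Flip? u | c u in cu
  ... | yes _ | true  = refl
  -- Here `u` would be flipped on account of another neighbour `w` of the new vertex in the same
  -- component, which `apart` excludes.
  ... | yes (w , (vw , cw) , π) | false =
    contradiction π (apart u vu w vw λ { refl → contradiction (trans (sym cu) cw) λ () })
  ... | no ¬f | true  = contradiction (u , (vu , cu) , Connected-refl t u) ¬f
  ... | no _  | false = refl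

  xor-cancelˡ : ∀ a {b d} → a xor b ≡ a xor d → b ≡ d
  xor-cancelˡ false e = e
  xor-cancelˡ true {b} {d} e = trans (sym (not-involutive b)) (trans (cong not e) (not-involutive d))

  c′-proper : Proper t c′
  -- Adjacent vertices lie in one component, so either both are flipped or neither is.
  c′-proper x y xy with Flip? x | Flip? y
  ... | yes _ | yes _ = λ e → c-proper x y xy (xor-cancelˡ true e)
  ... | no _  | no _  = c-proper x y xy
  ... | yes (u , h , π) | no ¬f = contradiction (u , h , Connected-step t (trans (adj-sym t y x) xy) π) ¬f
  ... | no ¬f | yes (u , h , π) = contradiction (u , h , Connected-step t xy π) ¬f

  proper : Proper (t , v) (λ x → extend (last? x))
  proper x y xy with last? x | last? y
  ... | nothing | just j  = λ e → contradiction (trans e (c′-neighbour j xy)) λ ()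
  ... | just i  | nothing = λ e → contradiction (trans (sym e) (c′-neighbour i xy)) λ ()
  ... | just i  | just j  = c′-proper i j xy

arc-< : ∀ {n} (t : Tour n) x y → toℕ x ℕ.< toℕ y → arc t x y ≡ not (adj t x y)
arc-< {suc n} (t , v) x y x<y with last? x in ex | last? y in ey
... | nothing | nothing =
  contradiction (ℕ.≤-reflexive (trans (toℕ-last?-nothing y ey) (sym (toℕ-last?-nothing x ex)))) (ℕ.<⇒≱ x<y)
... | nothing | just j  = contradiction (toℕ≤pred[n] y) (ℕ.<⇒≱ (subst (ℕ._< toℕ y) (toℕ-last?-nothing x ex) x<y))
... | just i  | nothing = refl
... | just i  | just j  = arc-< t i j (subst₂ ℕ._<_ (toℕ-last?-just x ex) (toℕ-last?-just y ey) x<y)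

arc-> : ∀ {n} (t : Tour n) x y → toℕ x ℕ.< toℕ y → arc t y x ≡ adj t x y
arc-> {suc n} (t , v) x y x<y with last? y in ey | last? x in ex
... | nothing | nothing =
  contradiction (ℕ.≤-reflexive (trans (toℕ-last?-nothing y ey) (sym (toℕ-last?-nothing x ex)))) (ℕ.<⇒≱ x<y)
... | just j  | nothing = contradiction (toℕ≤pred[n] y) (ℕ.<⇒≱ (subst (ℕ._< toℕ y) (toℕ-last?-nothing x ex) x<y))
... | nothing | just i  = refl
... | just j  | just i  = arc-> t i j (subst₂ ℕ._<_ (toℕ-last?-just x ex) (toℕ-last?-just y ey) x<y)

arc-irrefl : ∀ {n} (t : Tour n) x → arc t x x ≡ false
arc-irrefl {suc n} (t , v) x with last? x
... | nothing = refl
... | just i  = arc-irrefl t i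

-- Inside a colour class no arc is backward, so its arcs follow the order of the vertices, which is
-- transitive.
Proper⇒Colorable : ∀ {n} (t : Tour n) {c} → Proper t c → Colorable 2 t
Proper⇒Colorable t {c} proper = color ∘ c , transitive
  where
  color : Bool → Fin 2
  color false = zero
  color true  = suc zero

  color-injective : ∀ {a b} → color a ≡ color b → a ≡ b
  color-injective {false} {false} _ = refl
  color-injective {true}  {true}  _ = refl

  nonadj : ∀ x y → color (c x) ≡ color (c y) → adj t x y ≡ false
  nonadj x y e = ¬-not λ xy → proper x y xy (color-injective e)

  arc⇒< : ∀ x y → color (c x) ≡ color (c y) → arc t x y ≡ true → toℕ x ℕ.< toℕ y
  arc⇒< x y e xy with ℕ.<-cmp (toℕ x) (toℕ y)
  ... | tri< x<y _ _ = x<y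
  ... | tri≈ _ x≡y _ with refl ← toℕ-injective x≡y = contradiction (trans (sym xy) (arc-irrefl t x)) λ ()
  ... | tri> _ _ y<x = contradiction (trans (sym xy) (trans (arc-> t y x y<x) (nonadj y x (sym e)))) λ ()

  transitive : ∀ x y z → color (c x) ≡ color (c y) → color (c y) ≡ color (c z) →
    arc t x y ≡ true → arc t y z ≡ true → arc t x z ≡ true
  transitive x y z exy eyz xy yz =
    trans (arc-< t x z (ℕ.<-trans (arc⇒< x y exy xy) (arc⇒< y z eyz yz)))
          (cong not (nonadj x z (trans exy eyz)))

last?-inject₁ : ∀ {n} (i : Fin n) → last? (inject₁ i) ≡ just i
last?-inject₁ zero    = refl
last?-inject₁ (suc i) rewrite last?-inject₁ i = refl

last?-fromℕ : ∀ n → last? (Fin.fromℕ n) ≡ nothing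
last?-fromℕ zero    = refl
last?-fromℕ (suc n) rewrite last?-fromℕ n = refl

adj-inject₁ : ∀ {n} (t : Tour n) v x y → adj (t , v) (inject₁ x) (inject₁ y) ≡ adj t x y
adj-inject₁ t v x y rewrite last?-inject₁ x | last?-inject₁ y = refl

adj-fromℕ : ∀ {n} (t : Tour n) v i → adj (t , v) (Fin.fromℕ n) (inject₁ i) ≡ lookup v i
adj-fromℕ {n} t v i rewrite last?-fromℕ n | last?-inject₁ i = refl

-- Deleting edges cannot create paths, hence cannot create cycles. The inclusion of edges descends
-- to the earlier vertices through `inject₁`.
Forest-mono : ∀ {n} {t t′ : Tour n} → (∀ x y → adj t′ x y ≡ true → adj t x y ≡ true) → Forest t → Forest t′
Forest-mono {zero}  _ _ = tt
Forest-mono {suc n} {t , v} {t′ , v′} t′⊆t (forest , apart) =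
  Forest-mono old forest ,
  λ i v′i j v′j i≢j π → apart i (new i v′i) j (new j v′j) i≢j (Path-mono n id (λ _ _ → old _ _) π)
  where
  old : ∀ x y → adj t′ x y ≡ true → adj t x y ≡ true
  old x y e = trans (sym (adj-inject₁ t v x y)) (t′⊆t _ _ (trans (adj-inject₁ t′ v′ x y) e))
  new : ∀ i → lookup v′ i ≡ true → lookup v i ≡ true
  new i e = trans (sym (adj-fromℕ t v i)) (t′⊆t _ _ (trans (adj-fromℕ t′ v′ i) e))

-- Forced edges, and paths in a random forest

⟦⟧-yes : ∀ {A : Set} (d : Dec A) → A → ⟦ d ⟧ ≡ 1ℚ
⟦⟧-yes (yes _) _ = refl
⟦⟧-yes (no ¬a) a = contradiction a ¬a

⟦⟧-nonNeg : ∀ {A : Set} (d : Dec A) → 0ℚ ≤ ⟦ d ⟧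
⟦⟧-nonNeg d = val-nonNeg (does d)

⟦⟧≤1 : ∀ {A : Set} (d : Dec A) → ⟦ d ⟧ ≤ 1ℚ
⟦⟧≤1 d = val≤1 (does d)

sum-δ : ∀ {n} (y : Fin n) → sum (λ z → ⟦ z ≟ y ⟧) ≡ 1ℚ
sum-δ {suc n} zero    = trans (cong (1ℚ +_) (trans (sum-const n 0ℚ) (*-zeroʳ (fromℕ n)))) (+-identityʳ 1ℚ)
sum-δ {suc n} (suc y) = trans (+-identityˡ _) (sum-δ y)

lit : Bool → Bool → ℚ
lit true  c = val c
lit false c = val (not c)

⟦⟧-elim : ∀ {A : Set} (d : Dec A) (P : ℚ → Set) → (A → P 1ℚ) → (¬ A → P 0ℚ) → P ⟦ d ⟧
⟦⟧-elim (yes a) P f g = f a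
⟦⟧-elim (no ¬a) P f g = g ¬a

sameEdge? : ∀ {n} (x y u w : Fin n) → Dec (SameEdge x y u w)
sameEdge? x y u w = ((x ≟ u) ×-dec (y ≟ w)) ⊎-dec ((x ≟ w) ×-dec (y ≟ u))

module Edges (p : ℚ) (0≤p : 0ℚ ≤ p) (p≤1 : p ≤ 1ℚ) where
  open Expectation p 0≤p p≤1

  π : Bool → ℚ
  π b = if b then p else (1ℚ - p)

  π-nonNeg : ∀ b → 0ℚ ≤ π b
  π-nonNeg true  = 0≤p
  π-nonNeg false = 0≤1-p

  -- Once the edge is resampled, the literal is 0 for one value of the bit and 1 for the other, and
  -- the latter has probability `π b`.
  E-lit : ∀ n {x y} b → x ≢ y → (f : Tour n → ℚ) →
    E n (λ t → lit b (adj t x y) * f t) ≡ π b * E n (f ∘ setAdj b x y)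
  E-lit n {x} {y} b x≢y f = trans (E-resample n x≢y _) (trans
    (cong₂ (λ a c → p * a + (1ℚ - p) * c) (eval true) (eval false)) (select b))
    where
    eval : ∀ b′ → E n (λ t → lit b (adj (setAdj b′ x y t) x y) * f (setAdj b′ x y t)) ≡ lit b b′ * E n (f ∘ setAdj b′ x y)
    eval b′ = trans (E-cong n (λ t → cong (λ c → lit b c * f (setAdj b′ x y t)) (adj-setAdj b′ x y t x≢y)))
                    (E-* n (lit b b′) _)
    pick₁ : ∀ p u w → p * (1ℚ * u) + (1ℚ - p) * (0ℚ * w) ≡ p * u
    pick₁ = solve-∀ ℚ-ring
    pick₂ : ∀ p u w → p * (0ℚ * u) + (1ℚ - p) * (1ℚ * w) ≡ (1ℚ - p) * w
    pick₂ = solve-∀ ℚ-ring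
    select : ∀ b → p * (lit b true * E n (f ∘ setAdj true x y)) + (1ℚ - p) * (lit b false * E n (f ∘ setAdj false x y))
                   ≡ π b * E n (f ∘ setAdj b x y)
    select true  = pick₁ p (E n (f ∘ setAdj true x y)) (E n (f ∘ setAdj false x y))
    select false = pick₂ p (E n (f ∘ setAdj true x y)) (E n (f ∘ setAdj false x y))

  -- Deleting the edge xy is injective on the tournaments having it and multiplies
  -- weights by (1 - p) / p.
  E-adj-odds : ∀ n {x y} r → 0ℚ ≤ r → p ≤ r * (1ℚ - p) → x ≢ y → (f : Tour n → ℚ) → (∀ t → 0ℚ ≤ f t) →
    (∀ t → f (setAdj true x y t) ≤ f (setAdj false x y t)) →
    E n (λ t → val (adj t x y) * f t) ≤ r * E n f
  E-adj-odds n {x} {y} r 0≤r p≤r[1-p] x≢y f 0≤f on≤off = begin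
    E n (λ t → val (adj t x y) * f t)           ≡⟨ E-lit n true x≢y f ⟩
    p * on                                      ≤⟨ *-monoˡ-≤ 0≤p (E-mono n on≤off) ⟩
    p * off                                     ≤⟨ *-monoʳ-≤ (E-nonNeg n (λ t → 0≤f _)) p≤r[1-p] ⟩
    r * (1ℚ - p) * off                          ≡⟨ *-assoc r (1ℚ - p) off ⟩
    r * ((1ℚ - p) * off)                        ≤⟨ *-monoˡ-≤ 0≤r (≤-by (p * on) (+-comm (p * on) _) (*-nonNeg 0≤p (E-nonNeg n (λ t → 0≤f _)))) ⟩
    r * (p * on + (1ℚ - p) * off)               ≡⟨ cong (r *_) (E-resample n x≢y f) ⟨
    r * E n f                                   ∎
    where
    open ≤-Reasoning
    on  = E n (f ∘ setAdj true x y)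
    off = E n (f ∘ setAdj false x y)

  EV-lookup : ∀ n i (f : Vec Bool n → ℚ) →
    EV n (λ v → val (lookup v i) * f v) ≡ p * EV n (λ v → f (v [ i ]≔ true))
  EV-lookup (suc n) zero    f = begin
    p * EV n (λ v → 1ℚ * f (true ∷ v)) + (1ℚ - p) * EV n (λ v → 0ℚ * f (false ∷ v))
      ≡⟨ cong₂ (λ a b → p * a + (1ℚ - p) * b) (EV-cong n (λ v → *-identityˡ _))
           (trans (EV-cong n (λ v → *-zeroˡ (f (false ∷ v)))) (EV-const n 0ℚ)) ⟩
    p * a + (1ℚ - p) * 0ℚ
      ≡⟨ lemma p a ⟩
    p * (p * a + (1ℚ - p) * a) ∎
    where
    open ≡-Reasoning
    a = EV n (λ v → f (true ∷ v))
    lemma : ∀ p a → p * a + (1ℚ - p) * 0ℚ ≡ p * (p * a + (1ℚ - p) * a)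
    lemma = solve-∀ ℚ-ring
  EV-lookup (suc n) (suc i) f = trans
    (cong₂ (λ x y → p * x + (1ℚ - p) * y) (EV-lookup n i _) (EV-lookup n i _))
    (lemma p (1ℚ - p) _ _)
    where
    lemma : ∀ p q x y → p * (p * x) + q * (p * y) ≡ p * (p * x + q * y)
    lemma = solve-∀ ℚ-ring

  Φ : ℕ → ℚ
  Φ n = E n (λ t → ⟦ Forest? t ⟧)

  Φ-nonNeg : ∀ n → 0ℚ ≤ Φ n
  Φ-nonNeg n = E-nonNeg n (λ t → ⟦⟧-nonNeg (Forest? t))

  forestPath : ∀ {n} k A (x y : Fin n) → Tour n → ℚ
  forestPath k A x y t = ⟦ Forest? t ⟧ * ⟦ Path? (adj t) k A x y ⟧

  forestPath-nonNeg : ∀ {n} k A (x y : Fin n) t → 0ℚ ≤ forestPath k A x y t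
  forestPath-nonNeg k A x y t = *-nonNeg (⟦⟧-nonNeg (Forest? t)) (⟦⟧-nonNeg (Path? (adj t) k A x y))

  -- A union bound over the second vertex of the path, which exists because the ends differ.
  forestPath-step : ∀ {n} k A {x y : Fin n} → x ≢ y → ∀ t →
    forestPath (suc k) A x y t ≤ sum (λ z → val (adj t x z) * forestPath k (A ∖ x) z y t)
  forestPath-step k A {x} {y} x≢y t =
    ⟦⟧-elim (Path? (adj t) (suc k) A x y) (λ q → ⟦ Forest? t ⟧ * q ≤ sum term)
      (λ { (_ , inj₁ x≡y) → contradiction x≡y x≢y
         ; (_ , inj₂ (z , xz , π)) → ≤-trans (≤-reflexive (sym (term≡ z xz π))) (term≤sum term-nonNeg z) })
      (λ _ → ≤-trans (≤-reflexive (*-zeroʳ ⟦ Forest? t ⟧)) (sum-nonNeg term-nonNeg))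
    where
    term : Fin _ → ℚ
    term z = val (adj t x z) * forestPath k (A ∖ x) z y t
    term-nonNeg : ∀ z → 0ℚ ≤ term z
    term-nonNeg z = *-nonNeg (val-nonNeg (adj t x z)) (forestPath-nonNeg k (A ∖ x) z y t)
    term≡ : ∀ z → adj t x z ≡ true → Path (adj t) k (A ∖ x) z y → term z ≡ ⟦ Forest? t ⟧ * 1ℚ
    term≡ z xz π = trans (cong₂ _*_ (cong val xz) (cong (⟦ Forest? t ⟧ *_) (⟦⟧-yes (Path? (adj t) k (A ∖ x) z y) π)))
      (*-identityˡ (⟦ Forest? t ⟧ * 1ℚ))

  setAdj-⊆ : ∀ {n} {x z : Fin n} t → x ≢ z → ∀ u w →
    adj (setAdj false x z t) u w ≡ true → adj (setAdj true x z t) u w ≡ true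
  setAdj-⊆ {x = x} {z} t x≢z u w e with sameEdge? x z u w
  ... | yes (inj₁ (refl , refl)) = adj-setAdj true x z t x≢z
  ... | yes (inj₂ (refl , refl)) = trans (adj-sym (setAdj true x z t) z x) (adj-setAdj true x z t x≢z)
  ... | no ≁ = trans (adj-setAdj-≁ true x z t u w ≁) (trans (sym (adj-setAdj-≁ false x z t u w ≁)) e)

  -- The path stays in `A` without `x` and so does not use the edge between `x` and `z`, while being
  -- a forest survives the deletion of that edge. This is the monotonicity that `E-adj-odds` asks
  -- for.
  forestPath-setAdj : ∀ {n} k A {x z y : Fin n} → x ≢ z → ∀ t →
    forestPath k (A ∖ x) z y (setAdj true x z t) ≤ forestPath k (A ∖ x) z y (setAdj false x z t)
  forestPath-setAdj k A {x} {z} {y} x≢z t = *-mono-≤ (⟦⟧-nonNeg (Forest? on))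
    (⟦⟧-mono (Forest? on) (Forest? off) (Forest-mono (setAdj-⊆ t x≢z)))
    (⟦⟧-nonNeg (Path? (adj on) k (A ∖ x) z y))
    (⟦⟧-mono (Path? (adj on) k (A ∖ x) z y) (Path? (adj off) k (A ∖ x) z y)
      (Path-mono k id λ {u} {w} u∈ w∈ e → trans (adj-setAdj-≁ false x z t u w (≁ u∈ w∈))
        (trans (sym (adj-setAdj-≁ true x z t u w (≁ u∈ w∈))) e)))
    where
    on  = setAdj true x z t
    off = setAdj false x z t
    ≁ : ∀ {u w} → u ∈ A ∖ x → w ∈ A ∖ x → ¬ SameEdge x z u w
    ≁ u∈ w∈ (inj₁ (refl , _)) = x∉A∖x A x u∈
    ≁ u∈ w∈ (inj₂ (refl , _)) = x∉A∖x A x w∈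

  module PathBound (r Q : ℚ) (0≤r : 0ℚ ≤ r) (0≤Q : 0ℚ ≤ Q) (p≤r[1-p] : p ≤ r * (1ℚ - p)) where

    -- Here `r` bounds the odds p / (1 - p), and `Q` bounds the geometric series of the powers of n
    -- r, which count paths by length; `hQ` says that `Q` is at least what the recursion 1 + n r Q
    -- returns. In the induction the first edge costs a factor `r`, and the rest of the path is
    -- either over or covered by the induction hypothesis.
    E-forestPath-≤ : ∀ n → 1ℚ + fromℕ n * (r * Q) ≤ Q → ∀ k A {x y : Fin n} → x ≢ y →
      E n (forestPath k A x y) ≤ r * Q * Φ n
    E-forestPath-≤ n hQ zero    A x≢y = ≤-trans (≤-reflexive (trans (E-cong n (λ t → *-zeroʳ ⟦ Forest? t ⟧)) (E-const n 0ℚ)))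
      (*-nonNeg (*-nonNeg 0≤r 0≤Q) (Φ-nonNeg n))
    E-forestPath-≤ n hQ (suc k) A {x} {y} x≢y = begin
      E n (forestPath (suc k) A x y)
        ≤⟨ E-mono n (forestPath-step k A x≢y) ⟩
      E n (λ t → sum (λ z → val (adj t x z) * forestPath k (A ∖ x) z y t))
        ≡⟨ E-sum n (λ z t → val (adj t x z) * forestPath k (A ∖ x) z y t) ⟩
      sum (λ z → E n (λ t → val (adj t x z) * forestPath k (A ∖ x) z y t))
        ≤⟨ sum-mono bound ⟩
      sum (λ z → r * (⟦ z ≟ y ⟧ * Φ n + r * Q * Φ n))
        ≡⟨ *-distribˡ-sum r (λ z → ⟦ z ≟ y ⟧ * Φ n + r * Q * Φ n) ⟨
      r * sum (λ z → ⟦ z ≟ y ⟧ * Φ n + r * Q * Φ n)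
        ≡⟨ cong (r *_) (∑-distrib-+ (λ z → ⟦ z ≟ y ⟧ * Φ n) (λ _ → r * Q * Φ n)) ⟩
      r * (sum (λ z → ⟦ z ≟ y ⟧ * Φ n) + sum {n} (λ _ → r * Q * Φ n))
        ≡⟨ cong₂ (λ a b → r * (a + b)) (trans (sym (*-distribʳ-sum (Φ n) (λ z → ⟦ z ≟ y ⟧))) (cong (_* Φ n) (sum-δ y)))
             (sum-const n (r * Q * Φ n)) ⟩
      r * (1ℚ * Φ n + fromℕ n * (r * Q * Φ n))
        ≡⟨ rearrange r Q (Φ n) (fromℕ n) ⟩
      r * Φ n * (1ℚ + fromℕ n * (r * Q))
        ≤⟨ *-monoˡ-≤ (*-nonNeg 0≤r (Φ-nonNeg n)) hQ ⟩
      r * Φ n * Q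
        ≡⟨ swap r (Φ n) Q ⟩
      r * Q * Φ n ∎
      where
      open ≤-Reasoning
      rearrange : ∀ r Q F m → r * (1ℚ * F + m * (r * Q * F)) ≡ r * F * (1ℚ + m * (r * Q))
      rearrange = solve-∀ ℚ-ring
      swap : ∀ a b c → a * b * c ≡ a * c * b
      swap = solve-∀ ℚ-ring

      rest-nonNeg : 0ℚ ≤ r * Q * Φ n
      rest-nonNeg = *-nonNeg (*-nonNeg 0≤r 0≤Q) (Φ-nonNeg n)

      -- For `z` equal to `y` the path may end at once, and its indicator is only bounded by 1. This
      -- is the source of the summand `1ℚ` in `hQ`.
      path≤ : ∀ z → E n (forestPath k (A ∖ x) z y) ≤ ⟦ z ≟ y ⟧ * Φ n + r * Q * Φ n
      path≤ z with z ≟ y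
      ... | yes _ = ≤-trans
        (E-mono n (λ t → ≤-trans (*-monoˡ-≤ (⟦⟧-nonNeg (Forest? t)) (⟦⟧≤1 (Path? (adj t) k (A ∖ x) z y))) (≤-reflexive (*-identityʳ ⟦ Forest? t ⟧))))
        (≤-by (r * Q * Φ n) (cong (_+ r * Q * Φ n) (*-identityˡ (Φ n))) rest-nonNeg)
      ... | no z≢y = ≤-trans (E-forestPath-≤ n hQ k (A ∖ x) z≢y)
        (≤-reflexive (sym (trans (cong (_+ r * Q * Φ n) (*-zeroˡ (Φ n))) (+-identityˡ (r * Q * Φ n)))))

      bound : ∀ z → E n (λ t → val (adj t x z) * forestPath k (A ∖ x) z y t) ≤ r * (⟦ z ≟ y ⟧ * Φ n + r * Q * Φ n)
      bound z with x ≟ z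
      ... | no x≢z = ≤-trans
        (E-adj-odds n r 0≤r p≤r[1-p] x≢z _ (forestPath-nonNeg k (A ∖ x) z y) (forestPath-setAdj k A x≢z))
        (*-monoˡ-≤ 0≤r (path≤ z))
      ... | yes refl = ≤-trans
        (≤-reflexive (trans (E-cong n (λ t → trans (cong (λ c → val c * forestPath k (A ∖ x) x y t) (adj-irrefl t x)) (*-zeroˡ (forestPath k (A ∖ x) x y t)))) (E-const n 0ℚ)))
        (*-nonNeg 0≤r (+-nonNeg (*-nonNeg (val-nonNeg (does (x ≟ y))) (Φ-nonNeg n)) rest-nonNeg))

    -- A forest is lost only if the new vertex has backward arcs to two vertices of one component.
    -- The two new bits are independent of the old tournament and contribute p², the connecting path
    -- contributes `r * Q * Φ n`, and the double sum is a union bound over ordered pairs.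
    Φ-step : ∀ n → 1ℚ + fromℕ n * (r * Q) ≤ Q →
      Φ n ≤ Φ (suc n) + fromℕ n * (fromℕ n * (p * (p * (r * Q * Φ n))))
    Φ-step n hQ = begin
      Φ n
        ≡⟨ E-cong n (λ t → EV-const n ⟦ Forest? t ⟧) ⟨
      E (suc n) (λ (t , v) → ⟦ Forest? t ⟧)
        ≤⟨ E-mono (suc n) {g = λ (t , v) → ⟦ Forest? (t , v) ⟧ + sum (λ i → sum (λ j → closed i j t v))} pointwise ⟩
      E (suc n) (λ (t , v) → ⟦ Forest? (t , v) ⟧ + sum (λ i → sum (λ j → closed i j t v)))
        ≡⟨ E-+ (suc n) (λ (t , v) → ⟦ Forest? (t , v) ⟧) (λ (t , v) → sum (λ i → sum (λ j → closed i j t v))) ⟩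
      Φ (suc n) + E (suc n) (λ (t , v) → sum (λ i → sum (λ j → closed i j t v)))
        ≡⟨ cong (Φ (suc n) +_) (trans (E-sum (suc n) (λ i (t , v) → sum (λ j → closed i j t v)))
             (sum-cong-≗ λ i → E-sum (suc n) (λ j (t , v) → closed i j t v))) ⟩
      Φ (suc n) + sum (λ i → sum (λ j → E (suc n) (λ (t , v) → closed i j t v)))
        ≤⟨ +-monoʳ-≤ (Φ (suc n)) (sum-mono λ i → sum-mono λ j → closed≤ i j) ⟩
      Φ (suc n) + sum {n} (λ i → sum {n} (λ j → p * (p * (r * Q * Φ n))))
        ≡⟨ cong (Φ (suc n) +_) (trans (sum-cong-≗ {n} λ i → sum-const n _) (sum-const n _)) ⟩
      Φ (suc n) + fromℕ n * (fromℕ n * (p * (p * (r * Q * Φ n)))) ∎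
      where
      open ≤-Reasoning
      -- The diagonal is cut out, because a vertex is always connected to itself and the path bound
      -- covers distinct ends only.
      closed : Fin n → Fin n → Tour n → Vec Bool n → ℚ
      closed i j t v = val (lookup v i) * (val (lookup v j) * (⟦ ¬? (i ≟ j) ⟧ * forestPath n full i j t))

      closed-nonNeg : ∀ t v i j → 0ℚ ≤ closed i j t v
      closed-nonNeg t v i j = *-nonNeg (val-nonNeg (lookup v i)) (*-nonNeg (val-nonNeg (lookup v j))
        (*-nonNeg (val-nonNeg (not (does (i ≟ j)))) (forestPath-nonNeg n full i j t)))

      closed≤ : ∀ i j → E (suc n) (λ (t , v) → closed i j t v) ≤ p * (p * (r * Q * Φ n))
      closed≤ i j with i ≟ j
      ... | yes i≡j = ≤-trans (≤-reflexive (trans (E-cong (suc n) λ (t , v) → zero₃ (val (lookup v i)) (val (lookup v j)) (forestPath n full i j t))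
              (E-const (suc n) 0ℚ))) (*-nonNeg 0≤p (*-nonNeg 0≤p (*-nonNeg (*-nonNeg 0≤r 0≤Q) (Φ-nonNeg n))))
        where
        zero₃ : ∀ a b c → a * (b * (0ℚ * c)) ≡ 0ℚ
        zero₃ = solve-∀ ℚ-ring
      ... | no i≢j = begin
        E n (λ t → EV n (λ v → val (lookup v i) * (val (lookup v j) * (1ℚ * forestPath n full i j t))))
          ≡⟨ E-cong n (λ t → two t (1ℚ * forestPath n full i j t)) ⟩
        E n (λ t → p * (p * (1ℚ * forestPath n full i j t)))
          ≡⟨ trans (E-* n p _) (cong (p *_) (trans (E-* n p _) (cong (p *_) (E-* n 1ℚ (forestPath n full i j))))) ⟩
        p * (p * (1ℚ * E n (forestPath n full i j)))
          ≡⟨ cong (λ a → p * (p * a)) (*-identityˡ _) ⟩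
        p * (p * E n (forestPath n full i j))
          ≤⟨ *-monoˡ-≤ 0≤p (*-monoˡ-≤ 0≤p (E-forestPath-≤ n hQ n full i≢j)) ⟩
        p * (p * (r * Q * Φ n)) ∎
        where
        two : ∀ t c → EV n (λ v → val (lookup v i) * (val (lookup v j) * c)) ≡ p * (p * c)
        two t c = trans (EV-lookup n i (λ v → val (lookup v j) * c)) (cong (p *_) (trans
          (EV-cong n (λ v → cong (λ b → val b * c) (lookup∘update′ (≢-sym i≢j) v true)))
          (trans (EV-lookup n j (λ _ → c)) (cong (p *_) (EV-const n c)))))

      pointwise : ∀ ((t , v) : Tour (suc n)) → ⟦ Forest? t ⟧ ≤ ⟦ Forest? (t , v) ⟧ + sum (λ i → sum (λ j → closed i j t v))
      pointwise (t , v) =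
        ⟦⟧-elim (Forest? t) (λ q → q ≤ ⟦ Forest? (t , v) ⟧ + S) (λ f →
          ⟦⟧-elim (Forest? (t , v)) (λ q → 1ℚ ≤ q + S)
            (λ _ → ≤-by S refl S-nonNeg)
            (λ ¬f′ → ≤-trans (cycle f ¬f′) (≤-reflexive (sym (+-identityˡ S)))))
          (λ _ → +-nonNeg (⟦⟧-nonNeg (Forest? (t , v))) S-nonNeg)
        where
        S = sum (λ i → sum (λ j → closed i j t v))
        row-nonNeg : ∀ i → 0ℚ ≤ sum (λ j → closed i j t v)
        row-nonNeg i = sum-nonNeg (closed-nonNeg t v i)
        S-nonNeg : 0ℚ ≤ S
        S-nonNeg = sum-nonNeg row-nonNeg
        Closing : Fin n → Fin n → Set
        Closing i j = (lookup v i ≡ true × lookup v j ≡ true) × (i ≢ j × Connected t i j)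
        closing? : Dec (∃ λ i → ∃ λ j → Closing i j)
        closing? = any? λ i → any? λ j → ((lookup v i Bool.≟ true) ×-dec (lookup v j Bool.≟ true)) ×-dec
          (¬? (i ≟ j) ×-dec Connected? t i j)
        cycle : Forest t → ¬ Forest (t , v) → 1ℚ ≤ S
        cycle f ¬f′ with closing?
        ... | no ¬c = contradiction (f , λ i vi j vj i≢j π → ¬c (i , j , (vi , vj) , i≢j , π)) ¬f′
        ... | yes (i , j , (vi , vj) , i≢j , π) = begin
          1ℚ
            ≡⟨⟩
          1ℚ * (1ℚ * (1ℚ * (1ℚ * 1ℚ)))
            ≡⟨ cong₂ _*_ (cong val vi) (cong₂ _*_ (cong val vj) (cong₂ _*_ (⟦⟧-yes (¬? (i ≟ j)) i≢j)
                 (cong₂ _*_ (⟦⟧-yes (Forest? t) f) (⟦⟧-yes (Connected? t i j) π)))) ⟨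
          closed i j t v
            ≤⟨ term≤sum (closed-nonNeg t v i) j ⟩
          sum (λ j → closed i j t v)
            ≤⟨ term≤sum row-nonNeg i ⟩
          S ∎

-- Estimates with powers

-- The denominator of `h` is a witness: multiplied by it, `h` becomes its numerator, a positive
-- integer.
archimedean : ∀ h → 0ℚ < h → ∃ λ q → 1ℚ ≤ fromℕ q * h
archimedean h@(mkℚ (ℤ.+ suc k) d-1 _) _ = suc d-1 , toℚᵘ-cancel-≤ (ℚᵘ.≤-respʳ-≃
  (ℚᵘ.≃-sym (ℚᵘ.≃-trans (toℚᵘ-homo-* (fromℕ (suc d-1)) h) (ℚᵘ.*-congʳ {toℚᵘ h} (toℚᵘ-fromℕ (suc d-1)))))
  (ℚᵘ.*≤* (ℤ.+≤+ (ℕ.≤-trans (ℕ.≤-reflexive lemma) (ℕ.≤-trans (ℕ.m≤m*n (suc d-1) (suc k)) (ℕ.≤-reflexive (sym (ℕ.*-identityʳ _))))))))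
  where
  lemma : 1 ℕ.* (1 ℕ.* suc d-1) ≡ suc d-1
  lemma = trans (ℕ.*-identityˡ _) (ℕ.*-identityˡ _)
archimedean (mkℚ (ℤ.+ zero)   d-1 _) (ℚ.*<* (ℤ.+<+ ()))
archimedean (mkℚ (ℤ.-[1+ _ ]) d-1 _) (ℚ.*<* ())

^-nonNeg : ∀ {x} k → 0ℚ ≤ x → 0ℚ ≤ x ^ k
^-nonNeg zero    0≤x = 0≤1
^-nonNeg (suc k) 0≤x = *-nonNeg 0≤x (^-nonNeg k 0≤x)

^-pos : ∀ {x} k → 0ℚ < x → 0ℚ < x ^ k
^-pos zero    0<x = positive⁻¹ 1ℚ
^-pos (suc k) 0<x = *-pos 0<x (^-pos k 0<x)

^-mono-≤ : ∀ {x y} k → 0ℚ ≤ x → x ≤ y → x ^ k ≤ y ^ k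
^-mono-≤ zero    0≤x x≤y = ≤-refl
^-mono-≤ (suc k) 0≤x x≤y = *-mono-≤ 0≤x x≤y (^-nonNeg k 0≤x) (^-mono-≤ k 0≤x x≤y)

^-antimono-≤ : ∀ {x m n} → 0ℚ ≤ x → x ≤ 1ℚ → m ℕ.≤ n → x ^ n ≤ x ^ m
^-antimono-≤ {x} {n = zero}  0≤x x≤1 ℕ.z≤n = ≤-refl
^-antimono-≤ {x} {n = suc n} 0≤x x≤1 ℕ.z≤n = *-mono-≤ 0≤x x≤1 (^-nonNeg n 0≤x) (^-antimono-≤ {n = n} 0≤x x≤1 ℕ.z≤n)
^-antimono-≤ 0≤x x≤1 (ℕ.s≤s m≤n) = *-monoˡ-≤ 0≤x (^-antimono-≤ 0≤x x≤1 m≤n)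

bernoulli : ∀ {s} k → 0ℚ ≤ s → s ≤ 1ℚ → 1ℚ - fromℕ k * s ≤ (1ℚ - s) ^ k
bernoulli {s} zero    0≤s s≤1 = ≤-reflexive (cong (λ a → 1ℚ - a) (*-zeroˡ s))
bernoulli {s} (suc k) 0≤s s≤1 = ≤-trans
  (≤-by (fromℕ k * (s * s)) (lemma (fromℕ k) s) (*-nonNeg (fromℕ-nonNeg k) (*-nonNeg 0≤s 0≤s)))
  (*-monoˡ-≤ (0≤q-p s≤1) (bernoulli k 0≤s s≤1))
  where
  lemma : ∀ k s → (1ℚ - s) * (1ℚ - k * s) ≡ (1ℚ - (1ℚ + k) * s) + k * (s * s)
  lemma = solve-∀ ℚ-ring

-- A rational substitute for the convergence of (1 - q/n)^n to exp(-q). By Bernoulli, a block of `k`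
-- factors, about n / (2q) of them, has product at least ½, and `4 ℕ.* q` blocks cover all `n`
-- factors.
½^-≤ : ∀ q n → .{{_ : ℕ.NonZero q}} → .{{_ : ℕ.NonZero n}} → 2 ℕ.* q ℕ.≤ n → ½ ^ (4 ℕ.* q) ≤ (1ℚ - fromℕ q * inv n) ^ n
½^-≤ q@(suc _) n 2q≤n = begin
  ½ ^ (4 ℕ.* q)                     ≤⟨ ^-mono-≤ (4 ℕ.* q) (≤ᵇ⇒≤ _) half ⟩
  ((1ℚ - s) ^ k) ^ (4 ℕ.* q)        ≡⟨ ^-assocʳ (1ℚ - s) k (4 ℕ.* q) ⟩
  (1ℚ - s) ^ (k ℕ.* (4 ℕ.* q))      ≤⟨ ^-antimono-≤ (0≤q-p s≤1) (≤-by s (sym (lemma s)) 0≤s) n≤k*4q ⟩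
  (1ℚ - s) ^ n                      ∎
  where
  open ≤-Reasoning
  s = fromℕ q * inv n
  k = n ℕ./ (2 ℕ.* q)
  lemma : ∀ s → 1ℚ - s + s ≡ 1ℚ
  lemma = solve-∀ ℚ-ring
  0≤s : 0ℚ ≤ s
  0≤s = *-nonNeg (fromℕ-nonNeg q) (inv-nonNeg n)
  s≤1 : s ≤ 1ℚ
  s≤1 = ≤-trans (*-monoʳ-≤ (inv-nonNeg n) (fromℕ-mono-≤ (ℕ.≤-trans (ℕ.m≤m+n q _) 2q≤n))) (≤-reflexive (fromℕ*inv n))
  twice : fromℕ 2 * (fromℕ k * s) ≤ 1ℚ
  twice = begin
    fromℕ 2 * (fromℕ k * (fromℕ q * inv n))     ≡⟨ rearrange (fromℕ 2) (fromℕ k) (fromℕ q) (inv n) ⟩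
    fromℕ k * (fromℕ 2 * fromℕ q) * inv n       ≡⟨ cong (λ a → fromℕ k * a * inv n) (fromℕ-* 2 q) ⟨
    fromℕ k * fromℕ (2 ℕ.* q) * inv n           ≡⟨ cong (_* inv n) (fromℕ-* k (2 ℕ.* q)) ⟨
    fromℕ (k ℕ.* (2 ℕ.* q)) * inv n             ≤⟨ *-monoʳ-≤ (inv-nonNeg n) (fromℕ-mono-≤ (ℕ.m/n*n≤m n (2 ℕ.* q))) ⟩
    fromℕ n * inv n                             ≡⟨ fromℕ*inv n ⟩
    1ℚ ∎
    where
    rearrange : ∀ a b c d → a * (b * (c * d)) ≡ b * (a * c) * d
    rearrange = solve-∀ ℚ-ring
  half : ½ ≤ (1ℚ - s) ^ k
  half = ≤-trans (≤-by (½ * (1ℚ - fromℕ 2 * (fromℕ k * s))) (split (fromℕ k * s)) (*-nonNeg (≤ᵇ⇒≤ {0ℚ} {½} _) (0≤q-p twice)))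
    (bernoulli k 0≤s s≤1)
    where
    split : ∀ a → 1ℚ - a ≡ ½ + ½ * (1ℚ - fromℕ 2 * a)
    split = solve-∀ ℚ-ring
  n≤k*4q : n ℕ.≤ k ℕ.* (4 ℕ.* q)
  -- The remainder is less than `d`, hence at most `k ℕ.* d`, since `2q≤n` makes `k` positive.
  n≤k*4q = ℕ.≤-trans (ℕ.≤-reflexive (ℕ.m≡m%n+[m/n]*n n d)) (ℕ.≤-trans
    (ℕ.+-monoˡ-≤ (k ℕ.* d) (ℕ.≤-trans (ℕ.<⇒≤ (ℕ.m%n<n n d)) (ℕ.m≤n*m d k {{ℕ.>-nonZero (ℕ.m≥n⇒m/n>0 2q≤n)}})))
    (ℕ.≤-reflexive (double k q)))
    where
    d = 2 ℕ.* q
    double : ∀ k q → k ℕ.* (2 ℕ.* q) ℕ.+ k ℕ.* (2 ℕ.* q) ≡ k ℕ.* (4 ℕ.* q)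
    double = ℕ-solve-∀

-- Lower bound: the forest survives every new vertex

module LowerBound (h : ℚ) (0<h : 0ℚ < h) (2h<1 : h + h < 1ℚ)
                  (q : ℕ) (1≤qh : 1ℚ ≤ fromℕ q * h)
                  (n : ℕ) {{_ : ℕ.NonZero q}} {{_ : ℕ.NonZero n}} (2q≤n : 2 ℕ.* q ℕ.≤ n) where

  -- With `h` standing for half of ε, `p` is the given edge probability. The product n r is 1 - h,
  -- still below 1, and the gap between `r` and `p` absorbs the passage from `p` to its odds.
  p r i : ℚ
  i = inv n
  p = (1ℚ - (h + h)) * i
  r = (1ℚ - h) * i

  0≤i : 0ℚ ≤ i
  0≤i = inv-nonNeg n

  0≤h : 0ℚ ≤ h
  0≤h = <⇒≤ 0<h

  0≤1-2h : 0ℚ ≤ 1ℚ - (h + h)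
  0≤1-2h = 0≤q-p (<⇒≤ 2h<1)

  0≤1-h : 0ℚ ≤ 1ℚ - h
  0≤1-h = subst (0ℚ ≤_) (lemma h) (+-nonNeg 0≤1-2h 0≤h)
    where
    lemma : ∀ h → 1ℚ - (h + h) + h ≡ 1ℚ - h
    lemma = solve-∀ ℚ-ring

  0≤p : 0ℚ ≤ p
  0≤p = *-nonNeg 0≤1-2h 0≤i

  m*i≤1 : ∀ {m} → m ℕ.≤ n → fromℕ m * i ≤ 1ℚ
  m*i≤1 m≤n = ≤-trans (*-monoʳ-≤ 0≤i (fromℕ-mono-≤ m≤n)) (≤-reflexive (fromℕ*inv n))

  p≤i : p ≤ i
  p≤i = ≤-by ((h + h) * i) (lemma h i) (*-nonNeg (+-nonNeg 0≤h 0≤h) 0≤i)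
    where
    lemma : ∀ h i → i ≡ (1ℚ - (h + h)) * i + (h + h) * i
    lemma = solve-∀ ℚ-ring

  r≤i : r ≤ i
  r≤i = ≤-by (h * i) (lemma h i) (*-nonNeg 0≤h 0≤i)
    where
    lemma : ∀ h i → i ≡ (1ℚ - h) * i + h * i
    lemma = solve-∀ ℚ-ring

  i≤1 : i ≤ 1ℚ
  i≤1 = ≤-trans (≤-reflexive (sym (lemma i))) (m*i≤1 {1} (ℕ.>-nonZero⁻¹ n))
    where
    lemma : ∀ i → (1ℚ + 0ℚ) * i ≡ i
    lemma = solve-∀ ℚ-ring

  p≤1 : p ≤ 1ℚ
  p≤1 = ≤-trans p≤i i≤1

  Q : ℚ
  Q = fromℕ q

  q≤n : q ℕ.≤ n
  q≤n = ℕ.≤-trans (ℕ.m≤m+n q _) 2q≤n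

  i≤h : i ≤ h
  i≤h = begin
    i               ≡⟨ *-identityʳ i ⟨
    i * 1ℚ          ≤⟨ *-monoˡ-≤ 0≤i 1≤qh ⟩
    i * (Q * h)     ≡⟨ lemma i Q h ⟩
    Q * i * h       ≤⟨ *-monoʳ-≤ 0≤h (m*i≤1 q≤n) ⟩
    1ℚ * h          ≡⟨ *-identityˡ h ⟩
    h               ∎
    where
    open ≤-Reasoning
    lemma : ∀ i Q h → i * (Q * h) ≡ Q * i * h
    lemma = solve-∀ ℚ-ring

  -- The difference of `r` and `p` is `h * i`, whereas `r * p` is at most `i * i`; so `i≤h` is
  -- enough.
  p≤r[1-p] : p ≤ r * (1ℚ - p)
  p≤r[1-p] = ≤-by (i * ((h - i) + i * (h + (h + h) * (1ℚ - h)))) (lemma h i)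
    (*-nonNeg 0≤i (+-nonNeg (0≤q-p i≤h) (*-nonNeg 0≤i (+-nonNeg 0≤h (*-nonNeg (+-nonNeg 0≤h 0≤h) 0≤1-h)))))
    where
    lemma : ∀ h i → (1ℚ - h) * i * (1ℚ - (1ℚ - (h + h)) * i) ≡
      (1ℚ - (h + h)) * i + i * ((h - i) + i * (h + (h + h) * (1ℚ - h)))
    lemma = solve-∀ ℚ-ring

  open Expectation p 0≤p p≤1
  open Edges p 0≤p p≤1
  open PathBound r Q (*-nonNeg 0≤1-h 0≤i) (fromℕ-nonNeg q) p≤r[1-p]

  -- Since m i is at most 1, the worst case reads 1 + (1 - h) Q ≤ Q, which is `1≤qh`.
  fixedPoint : ∀ {m} → m ℕ.≤ n → 1ℚ + fromℕ m * (r * Q) ≤ Q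
  fixedPoint {m} m≤n = ≤-by ((Q * h - 1ℚ) + (1ℚ - h) * Q * (1ℚ - fromℕ m * i)) (lemma Q h i (fromℕ m))
    (+-nonNeg (0≤q-p 1≤qh) (*-nonNeg (*-nonNeg 0≤1-h (fromℕ-nonNeg q)) (0≤q-p (m*i≤1 m≤n))))
    where
    lemma : ∀ Q h i m → Q ≡ 1ℚ + m * ((1ℚ - h) * i * Q) + ((Q * h - 1ℚ) + (1ℚ - h) * Q * (1ℚ - m * i))
    lemma = solve-∀ ℚ-ring

  s : ℚ
  s = Q * i

  s≤1 : s ≤ 1ℚ
  s≤1 = m*i≤1 q≤n

  -- Both products m p are at most 1 and `r` is at most 1/n, so a new vertex destroys at most the
  -- fraction `s`, that is q/n, of the forests.
  loss : ∀ {m} → m ℕ.≤ n → fromℕ m * (fromℕ m * (p * (p * (r * Q * Φ m)))) ≤ s * Φ m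
  loss {m} m≤n = begin
    fromℕ m * (fromℕ m * (p * (p * (r * Q * Φ m))))     ≡⟨ lemma (fromℕ m) p r Q (Φ m) ⟩
    fromℕ m * p * (fromℕ m * p * (r * (Q * Φ m)))       ≤⟨ *-mono-≤ 0≤mp mp≤1 (*-nonNeg 0≤mp rest) (*-mono-≤ 0≤mp mp≤1 rest (*-monoʳ-≤ 0≤QΦ r≤i)) ⟩
    1ℚ * (1ℚ * (i * (Q * Φ m)))                         ≡⟨ lemma′ i Q (Φ m) ⟩
    s * Φ m                                             ∎
    where
    open ≤-Reasoning
    lemma : ∀ m p r Q F → m * (m * (p * (p * (r * Q * F)))) ≡ m * p * (m * p * (r * (Q * F)))
    lemma = solve-∀ ℚ-ring
    lemma′ : ∀ i Q F → 1ℚ * (1ℚ * (i * (Q * F))) ≡ Q * i * F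
    lemma′ = solve-∀ ℚ-ring
    0≤mp : 0ℚ ≤ fromℕ m * p
    0≤mp = *-nonNeg (fromℕ-nonNeg m) 0≤p
    mp≤1 : fromℕ m * p ≤ 1ℚ
    mp≤1 = ≤-trans (*-monoˡ-≤ (fromℕ-nonNeg m) p≤i) (m*i≤1 m≤n)
    0≤QΦ : 0ℚ ≤ Q * Φ m
    0≤QΦ = *-nonNeg (fromℕ-nonNeg q) (Φ-nonNeg m)
    rest : 0ℚ ≤ r * (Q * Φ m)
    rest = *-nonNeg (*-nonNeg 0≤1-h 0≤i) 0≤QΦ

  Φ-≥ : ∀ m → m ℕ.≤ n → (1ℚ - s) ^ m ≤ Φ m
  Φ-≥ zero    _   = ≤-refl
  Φ-≥ (suc m) m<n = ≤-trans (*-monoˡ-≤ (0≤q-p s≤1) (Φ-≥ m m≤n))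
    (≤-by (Φ (suc m) + s * Φ m - Φ m) (lemma (Φ m) (Φ (suc m)) s)
      (0≤q-p (≤-trans (Φ-step m (fixedPoint m≤n)) (+-monoʳ-≤ (Φ (suc m)) (loss m≤n)))))
    where
    m≤n = ℕ.<⇒≤ m<n
    lemma : ∀ a b s → b ≡ (1ℚ - s) * a + (b + s * a - a)
    lemma = solve-∀ ℚ-ring

  Pr-≥ : (d : ∀ t → Dec (χ≤ {n} 2 t)) → ½ ^ (4 ℕ.* q) ≤ Pr n p (χ≤ 2) d
  Pr-≥ d = begin
    ½ ^ (4 ℕ.* q)           ≤⟨ ½^-≤ q n 2q≤n ⟩
    (1ℚ - s) ^ n            ≤⟨ Φ-≥ n ℕ.≤-refl ⟩
    Φ n                     ≤⟨ E-mono n (λ t → ⟦⟧-mono (Forest? t) (d t) (λ f → Proper⇒Colorable t (proj₂ (Forest⇒Proper t f)))) ⟩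
    E n (λ t → ⟦ d t ⟧)     ≡⟨ Pr≡E n (χ≤ 2) d ⟨
    Pr n p (χ≤ 2) d         ∎
    where open ≤-Reasoning

-- The obstruction to 2-colourability

module _ {n} (t : Tour n) (c : Fin n → Fin 2)
         (transitive : ∀ x y z → c x ≡ c y → c y ≡ c z → arc t x y ≡ true → arc t y z ≡ true → arc t x z ≡ true) where

  two-colours : ∀ {i j k : Fin 2} → i ≢ k → j ≢ k → i ≡ j
  two-colours {0F} {0F} _ _ = refl
  two-colours {1F} {1F} _ _ = refl
  two-colours {0F} {1F} {0F} i≢k _ = contradiction refl i≢k
  two-colours {0F} {1F} {1F} _ j≢k = contradiction refl j≢k
  two-colours {1F} {0F} {0F} _ j≢k = contradiction refl j≢k
  two-colours {1F} {0F} {1F} i≢k _ = contradiction refl i≢k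

  forward : ∀ {x y} → toℕ x ℕ.< toℕ y → adj t x y ≡ false → arc t x y ≡ true
  forward {x} {y} x<y e = trans (arc-< t x y x<y) (cong not e)

  backward : ∀ {x y} → toℕ x ℕ.< toℕ y → adj t x y ≡ true → arc t x y ≢ true
  backward {x} {y} x<y e e′ = contradiction (trans (sym e′) (trans (arc-< t x y x<y) (cong not e))) λ ()

  -- If x and y have the same colour, then every vertex w with x → w → y → x has the other colour,
  -- so the cyclic triangle a → b → d → a is monochromatic.
  gadget : ∀ {x a b d y} → toℕ x ℕ.< toℕ a → toℕ a ℕ.< toℕ b → toℕ b ℕ.< toℕ d → toℕ d ℕ.< toℕ y →
    adj t x y ≡ true → adj t x a ≡ false → adj t x b ≡ false → adj t x d ≡ false →
    adj t a y ≡ false → adj t b y ≡ false → adj t d y ≡ false →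
    adj t a d ≡ true → adj t a b ≡ false → adj t b d ≡ false → c x ≢ c y
  gadget {x} {a} {b} {d} {y} x<a a<b b<d d<y xy xa xb xd ay by dy ad ab bd cx≡cy =
    backward (ℕ.<-trans a<b b<d) ad (transitive a b d
      (two-colours (between xa x<a ay (ℕ.<-trans b<d′ d<y)) (between xb (ℕ.<-trans x<a a<b) by (ℕ.<-trans b<d d<y)))
      (two-colours (between xb (ℕ.<-trans x<a a<b) by (ℕ.<-trans b<d d<y)) (between xd (ℕ.<-trans x<a b<d′) dy d<y))
      (forward a<b ab) (forward b<d bd))
    where
    b<d′ = ℕ.<-trans a<b b<d
    x<y = ℕ.<-trans x<a (ℕ.<-trans b<d′ d<y)
    between : ∀ {w} → adj t x w ≡ false → toℕ x ℕ.< toℕ w → adj t w y ≡ false → toℕ w ℕ.< toℕ y → c w ≢ c x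
    between {w} xw x<w wy w<y cw≡cx = backward x<y xy
      (transitive x w y (sym cw≡cx) (trans cw≡cx cx≡cy) (forward x<w xw) (forward w<y wy))

Literal : Set
Literal = Bool × Fin 9 × Fin 9

-- Nine vertices 0 < 1 < … < 8, where 0, 4, 8 form a triangle of backward arcs and
-- 1 → 2 → 3 → 1 and 5 → 6 → 7 → 5 are cyclic.
backs forwards pattern-literals : List Literal
backs = (true , 0F , 4F) ∷ (true , 4F , 8F) ∷ (true , 0F , 8F) ∷ (true , 1F , 3F) ∷ (true , 5F , 7F) ∷ []
forwards =
  (false , 0F , 1F) ∷ (false , 0F , 2F) ∷ (false , 0F , 3F) ∷ (false , 1F , 4F) ∷ (false , 2F , 4F) ∷
  (false , 3F , 4F) ∷ (false , 1F , 8F) ∷ (false , 2F , 8F) ∷ (false , 3F , 8F) ∷ (false , 1F , 2F) ∷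
  (false , 2F , 3F) ∷ (false , 4F , 5F) ∷ (false , 4F , 6F) ∷ (false , 4F , 7F) ∷ (false , 5F , 8F) ∷
  (false , 6F , 8F) ∷ (false , 7F , 8F) ∷ (false , 5F , 6F) ∷ (false , 6F , 7F) ∷ []
pattern-literals = backs ++ forwards

Loopless : Literal → Set
Loopless (_ , x , y) = x ≢ y

Disjoint : Literal → Literal → Set
Disjoint (_ , x , y) (_ , u , w) = ¬ SameEdge x y u w

disjoint? : ∀ l l′ → Dec (Disjoint l l′)
disjoint? (_ , x , y) (_ , u , w) = ¬? (sameEdge? x y u w)

pattern-loopless : All Loopless pattern-literals
pattern-loopless = from-yes (All.all? (λ (_ , x , y) → ¬? (x ≟ y)) pattern-literals)

pattern-disjoint : AllPairs Disjoint pattern-literals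
pattern-disjoint = from-yes (AllPairs.allPairs? disjoint? pattern-literals)

∏ : ∀ {A : Set} → (A → ℚ) → List A → ℚ
∏ f []       = 1ℚ
∏ f (x ∷ xs) = f x * ∏ f xs

∏-nonNeg : ∀ {A : Set} {f : A → ℚ} xs → (∀ x → 0ℚ ≤ f x) → 0ℚ ≤ ∏ f xs
∏-nonNeg []       0≤f = 0≤1
∏-nonNeg (x ∷ xs) 0≤f = *-nonNeg (0≤f x) (∏-nonNeg xs 0≤f)

∏-≤1 : ∀ {A : Set} {f : A → ℚ} xs → (∀ x → 0ℚ ≤ f x) → (∀ x → f x ≤ 1ℚ) → ∏ f xs ≤ 1ℚ
∏-≤1 []       0≤f f≤1 = ≤-refl
∏-≤1 (x ∷ xs) 0≤f f≤1 = *-mono-≤ (0≤f x) (f≤1 x) (∏-nonNeg xs 0≤f) (∏-≤1 xs 0≤f f≤1)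

∏-++ : ∀ {A : Set} (f : A → ℚ) xs ys → ∏ f (xs ++ ys) ≡ ∏ f xs * ∏ f ys
∏-++ f []       ys = sym (*-identityˡ (∏ f ys))
∏-++ f (x ∷ xs) ys = trans (cong (f x *_) (∏-++ f xs ys)) (sym (*-assoc (f x) (∏ f xs) (∏ f ys)))

∏-* : ∀ {A : Set} (f g : A → ℚ) xs → ∏ f xs * ∏ g xs ≡ ∏ (λ x → f x * g x) xs
∏-* f g []       = refl
∏-* f g (x ∷ xs) = trans (lemma (f x) (∏ f xs) (g x) (∏ g xs)) (cong (f x * g x *_) (∏-* f g xs))
  where
  lemma : ∀ a b c d → a * b * (c * d) ≡ a * c * (b * d)
  lemma = solve-∀ ℚ-ring

lit-nonNeg : ∀ b c → 0ℚ ≤ lit b c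
lit-nonNeg true  c = val-nonNeg c
lit-nonNeg false c = val-nonNeg (not c)

lit≤1 : ∀ b c → lit b c ≤ 1ℚ
lit≤1 true  c = val≤1 c
lit≤1 false c = val≤1 (not c)

lit-idem : ∀ b c → lit b c * lit b c ≡ lit b c
lit-idem true  true  = refl
lit-idem true  false = refl
lit-idem false true  = refl
lit-idem false false = refl

sumVec : ∀ M k → (Vec (Fin M) k → ℚ) → ℚ
sumVec M zero    f = f []
sumVec M (suc k) f = sum (λ i → sumVec M k (λ s → f (i ∷ s)))

sumVec-mono : ∀ M k {f g} → (∀ s → f s ≤ g s) → sumVec M k f ≤ sumVec M k g
sumVec-mono M zero    f≤g = f≤g []
sumVec-mono M (suc k) f≤g = sum-mono λ i → sumVec-mono M k (λ s → f≤g (i ∷ s))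

sumVec-cong : ∀ M k {f g} → (∀ s → f s ≡ g s) → sumVec M k f ≡ sumVec M k g
sumVec-cong M zero    f≗g = f≗g []
sumVec-cong M (suc k) f≗g = sum-cong-≗ λ i → sumVec-cong M k (λ s → f≗g (i ∷ s))

sumVec-* : ∀ M k a f → sumVec M k (λ s → a * f s) ≡ a * sumVec M k f
sumVec-* M zero    a f = refl
sumVec-* M (suc k) a f = trans (sum-cong-≗ λ i → sumVec-* M k a (λ s → f (i ∷ s)))
  (sym (*-distribˡ-sum a (λ i → sumVec M k (λ s → f (i ∷ s)))))

sumVec-const : ∀ M k c → sumVec M k (λ _ → c) ≡ fromℕ M ^ k * c
sumVec-const M zero    c = sym (*-identityˡ c)
sumVec-const M (suc k) c = trans (sum-cong-≗ {M} λ i → sumVec-const M k c)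
  (trans (sum-const M _) (sym (*-assoc (fromℕ M) (fromℕ M ^ k) c)))

∏-zero-or-All : ∀ {A : Set} {f : A → ℚ} {P : A → Set} → (∀ x → f x ≡ 0ℚ ⊎ P x) → ∀ xs → ∏ f xs ≡ 0ℚ ⊎ All P xs
∏-zero-or-All dichotomy [] = inj₂ []
∏-zero-or-All {f = f} dichotomy (x ∷ xs) with dichotomy x | ∏-zero-or-All dichotomy xs
... | inj₁ e  | _       = inj₁ (trans (cong (_* ∏ f xs) e) (*-zeroˡ (∏ f xs)))
... | inj₂ _  | inj₁ e  = inj₁ (trans (cong (f x *_) e) (*-zeroʳ (f x)))
... | inj₂ px | inj₂ ps = inj₂ (px ∷ ps)

lit-zero-or-≡ : ∀ b c → lit b c ≡ 0ℚ ⊎ c ≡ b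
lit-zero-or-≡ true  true  = inj₂ refl
lit-zero-or-≡ true  false = inj₁ refl
lit-zero-or-≡ false true  = inj₁ refl
lit-zero-or-≡ false false = inj₂ refl

-- Copies of the pattern and their joint probabilities

module Copies (M′ n : ℕ) (9M≤n : 9 ℕ.* suc M′ ℕ.≤ n) where

  M : ℕ
  M = suc M′

  -- Vertices 0, 4, 8, 3, 7 of the pattern range over whole blocks of M consecutive
  -- vertices, the others are the first vertices of their blocks; so there are M⁵
  -- candidate copies and each contains five backward arcs.
  index : Vec (Fin M) 5 → Fin 9 → Fin M
  index (i ∷ j ∷ k ∷ b ∷ d ∷ []) 0F = i
  index (i ∷ j ∷ k ∷ b ∷ d ∷ []) 3F = b
  index (i ∷ j ∷ k ∷ b ∷ d ∷ []) 4F = j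
  index (i ∷ j ∷ k ∷ b ∷ d ∷ []) 7F = d
  index (i ∷ j ∷ k ∷ b ∷ d ∷ []) 8F = k
  index _                        _  = zero

  vertex : Vec (Fin M) 5 → Fin 9 → Fin n
  vertex s x = inject≤ (combine x (index s x)) 9M≤n

  -- Different pattern vertices live in disjoint blocks, even for two different copies. Hence two
  -- copies can share an edge only in the same position of the pattern.
  vertex-injective : ∀ s s′ {x y} → vertex s x ≡ vertex s′ y → x ≡ y × index s x ≡ index s′ y
  vertex-injective s s′ {x} {y} e = combine-injective x _ y _ (inject≤-injective 9M≤n 9M≤n _ _ e)

  vertex-< : ∀ s {x y} → x Fin.< y → toℕ (vertex s x) ℕ.< toℕ (vertex s y)
  vertex-< s {x} {y} x<y = subst₂ ℕ._<_ (sym (toℕ-inject≤ _ 9M≤n)) (sym (toℕ-inject≤ _ 9M≤n))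
    (combine-monoˡ-< (index s x) (index s y) x<y)

  literal : Vec (Fin M) 5 → Literal → Tour n → ℚ
  literal s (b , x , y) t = lit b (adj t (vertex s x) (vertex s y))

  literal-nonNeg : ∀ s l t → 0ℚ ≤ literal s l t
  literal-nonNeg s (b , x , y) t = lit-nonNeg b (adj t (vertex s x) (vertex s y))

  literal≤1 : ∀ s l t → literal s l t ≤ 1ℚ
  literal≤1 s (b , x , y) t = lit≤1 b (adj t (vertex s x) (vertex s y))

  copy : Vec (Fin M) 5 → Tour n → ℚ
  copy s t = ∏ (λ l → literal s l t) pattern-literals

  copy-nonNeg : ∀ s t → 0ℚ ≤ copy s t
  copy-nonNeg s t = ∏-nonNeg pattern-literals (λ l → literal-nonNeg s l t)

  -- For the second moment an upper bound suffices, and the forward literals, each of probability at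
  -- least ½ later on, change it by a constant factor only.
  copy≤backs : ∀ s t → copy s t ≤ ∏ (λ l → literal s l t) backs
  copy≤backs s t = begin
    copy s t                                                               ≡⟨ ∏-++ (λ l → literal s l t) backs forwards ⟩
    ∏ (λ l → literal s l t) backs * ∏ (λ l → literal s l t) forwards       ≤⟨ *-monoˡ-≤ (∏-nonNeg backs (λ l → literal-nonNeg s l t))
                                                                                (∏-≤1 forwards (λ l → literal-nonNeg s l t) (λ l → literal≤1 s l t)) ⟩
    ∏ (λ l → literal s l t) backs * 1ℚ                                     ≡⟨ *-identityʳ (∏ (λ l → literal s l t) backs) ⟩
    ∏ (λ l → literal s l t) backs                                          ∎
    where open ≤-Reasoning

  -- In a copy, `gadget` makes the colours of 0, 4 and 8 pairwise different, which two colours do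
  -- not allow. The triangle 1 2 3 lies between 0 and 4 and also between 0 and 8, so it serves both
  -- pairs; 5 6 7 serves 4 and 8.
  Colorable⇒no-copy : ∀ t → Colorable 2 t → ∀ s → copy s t ≡ 0ℚ
  Colorable⇒no-copy t (c , transitive) s
    with ∏-zero-or-All {f = λ l → literal s l t} (λ (b , x , y) → lit-zero-or-≡ b (adj t (vertex s x) (vertex s y))) pattern-literals
  ... | inj₁ e = e
  ... | inj₂ (e04 ∷ e48 ∷ e08 ∷ e13 ∷ e57 ∷
              n01 ∷ n02 ∷ n03 ∷ n14 ∷ n24 ∷ n34 ∷ n18 ∷ n28 ∷ n38 ∷ n12 ∷ n23 ∷
              n45 ∷ n46 ∷ n47 ∷ n58 ∷ n68 ∷ n78 ∷ n56 ∷ n67 ∷ []) =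
    contradiction (two-colours t c transitive c0≢c4 (≢-sym c4≢c8)) c0≢c8
    where
    lt : ∀ {x y} → x Fin.< y → toℕ (vertex s x) ℕ.< toℕ (vertex s y)
    lt = vertex-< s
    c0≢c4 = gadget t c transitive (lt {0F} {1F} (ℕ.≤ᵇ⇒≤ 1 1 _)) (lt {1F} {2F} (ℕ.≤ᵇ⇒≤ 2 2 _)) (lt {2F} {3F} (ℕ.≤ᵇ⇒≤ 3 3 _)) (lt {3F} {4F} (ℕ.≤ᵇ⇒≤ 4 4 _))
      e04 n01 n02 n03 n14 n24 n34 e13 n12 n23
    c0≢c8 = gadget t c transitive (lt {0F} {1F} (ℕ.≤ᵇ⇒≤ 1 1 _)) (lt {1F} {2F} (ℕ.≤ᵇ⇒≤ 2 2 _)) (lt {2F} {3F} (ℕ.≤ᵇ⇒≤ 3 3 _)) (lt {3F} {8F} (ℕ.≤ᵇ⇒≤ 4 8 _))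
      e08 n01 n02 n03 n18 n28 n38 e13 n12 n23
    c4≢c8 = gadget t c transitive (lt {4F} {5F} (ℕ.≤ᵇ⇒≤ 5 5 _)) (lt {5F} {6F} (ℕ.≤ᵇ⇒≤ 6 6 _)) (lt {6F} {7F} (ℕ.≤ᵇ⇒≤ 7 7 _)) (lt {7F} {8F} (ℕ.≤ᵇ⇒≤ 8 8 _))
      e48 n45 n46 n47 n58 n68 n78 e57 n56 n67

  -- By `vertex-injective`, forcing a literal of one copy touches no literal of any copy at another
  -- position of the pattern.
  ∏-literal-setAdj : ∀ s s′ l L → All (Disjoint l) L → ∀ t → let (b , x , y) = l in
    ∏ (λ l′ → literal s′ l′ (setAdj b (vertex s x) (vertex s y) t)) L ≡ ∏ (λ l′ → literal s′ l′ t) L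
  ∏-literal-setAdj s s′ l           []                 []        t = refl
  ∏-literal-setAdj s s′ l@(b , x , y) ((b′ , u , w) ∷ L) (l≁ ∷ L≁) t = cong₂ _*_
    (cong (lit b′) (adj-setAdj-≁ b (vertex s x) (vertex s y) t (vertex s′ u) (vertex s′ w) λ
      { (inj₁ (e , f)) → l≁ (inj₁ (proj₁ (vertex-injective s s′ e) , proj₁ (vertex-injective s s′ f)))
      ; (inj₂ (e , f)) → l≁ (inj₂ (proj₁ (vertex-injective s s′ e) , proj₁ (vertex-injective s s′ f))) }))
    (∏-literal-setAdj s s′ l L L≁ t)

  module Moments (p : ℚ) (0≤p : 0ℚ ≤ p) (p≤1 : p ≤ 1ℚ) (Mp≤1 : fromℕ M * p ≤ 1ℚ) where
    open Expectation p 0≤p p≤1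
    open Edges p 0≤p p≤1

    -- The literals concern different edges, so forcing one leaves the others alone and the
    -- probabilities multiply.
    E-∏-literal : ∀ s L → All Loopless L → AllPairs Disjoint L →
      E n (λ t → ∏ (λ l → literal s l t) L) ≡ ∏ (π ∘ proj₁) L
    E-∏-literal s [] [] [] = E-const n 1ℚ
    E-∏-literal s ((b , x , y) ∷ L) (x≢y ∷ loopless) (l≁ ∷ L≁) = trans
      (E-lit n b (x≢y ∘ proj₁ ∘ vertex-injective s s) (λ t → ∏ (λ l → literal s l t) L))
      (cong (π b *_) (trans (E-cong n (∏-literal-setAdj s s (b , x , y) L l≁)) (E-∏-literal s L loopless L≁)))

    δ : ∀ {k} → Fin k → Fin k → ℚ
    δ i j = ⟦ i ≟ j ⟧

    -- A bound for the probability that a literal holds in both copies: `π b` if the two edges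
    -- coincide and its square otherwise. Writing coincidence as a product of `δ` over the ends
    -- merges the cases, at the price of an extra square when the edges coincide.
    joint : Vec (Fin M) 5 → Vec (Fin M) 5 → Literal → ℚ
    joint s s′ (b , x , y) = π b * (π b + δ (index s′ x) (index s x) * δ (index s′ y) (index s y))

    δ-nonNeg : ∀ {k} (i j : Fin k) → 0ℚ ≤ δ i j
    δ-nonNeg i j = ⟦⟧-nonNeg (i ≟ j)

    joint-nonNeg : ∀ s s′ l → 0ℚ ≤ joint s s′ l
    joint-nonNeg s s′ (b , x , y) = *-nonNeg (π-nonNeg b) (+-nonNeg (π-nonNeg b)
      (*-nonNeg (δ-nonNeg (index s′ x) (index s x)) (δ-nonNeg (index s′ y) (index s y))))

    -- If the two edges coincide, the two factors are equal and idempotent; otherwise they can be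
    -- forced one after the other. The conditions on `f` say that it ignores both edges.
    E-literal² : ∀ s s′ l (f : Tour n → ℚ) → (∀ t → 0ℚ ≤ f t) → Loopless l → let (b , x , y) = l in
      (∀ t → f (setAdj b (vertex s x) (vertex s y) t) ≡ f t) →
      (∀ t → f (setAdj b (vertex s′ x) (vertex s′ y) t) ≡ f t) →
      E n (λ t → literal s l t * literal s′ l t * f t) ≤ joint s s′ l * E n f
    E-literal² s s′ l@(b , x , y) f 0≤f x≢y fs fs′
      with (index s′ x ≟ index s x) ×-dec (index s′ y ≟ index s y)
    ... | yes (ex , ey) = begin
      E n (λ t → literal s l t * literal s′ l t * f t)
        ≡⟨ E-cong n (λ t → cong (_* f t) (trans (cong (literal s l t *_) (same t)) (lit-idem b (adj t (vertex s x) (vertex s y))))) ⟩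
      E n (λ t → literal s l t * f t)
        ≡⟨ trans (E-lit n b (x≢y ∘ proj₁ ∘ vertex-injective s s) f) (cong (π b *_) (E-cong n fs)) ⟩
      π b * E n f
        ≤⟨ ≤-by (π b * π b * E n f) (lemma (π b) (E n f)) (*-nonNeg (*-nonNeg (π-nonNeg b) (π-nonNeg b)) (E-nonNeg n 0≤f)) ⟩
      π b * (π b + 1ℚ * 1ℚ) * E n f
        ≡⟨ cong₂ (λ c d → π b * (π b + c * d) * E n f) (⟦⟧-yes (index s′ x ≟ index s x) ex) (⟦⟧-yes (index s′ y ≟ index s y) ey) ⟨
      joint s s′ l * E n f ∎
      where
      open ≤-Reasoning
      lemma : ∀ q e → q * (q + 1ℚ * 1ℚ) * e ≡ q * e + q * q * e
      lemma = solve-∀ ℚ-ring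
      same : ∀ t → literal s′ l t ≡ literal s l t
      same t = cong₂ (λ i j → lit b (adj t (inject≤ (combine x i) 9M≤n) (inject≤ (combine y j) 9M≤n))) ex ey
    ... | no ¬e = begin
      E n (λ t → literal s l t * literal s′ l t * f t)
        ≡⟨ E-cong n (λ t → *-assoc (literal s l t) (literal s′ l t) (f t)) ⟩
      E n (λ t → literal s l t * (literal s′ l t * f t))
        ≡⟨ E-lit n b (x≢y ∘ proj₁ ∘ vertex-injective s s) _ ⟩
      π b * E n (λ t → literal s′ l (set t) * f (set t))
        ≡⟨ cong (π b *_) (E-cong n λ t → cong₂ _*_ (cong (lit b) (adj-setAdj-≁ b (vertex s x) (vertex s y) t (vertex s′ x) (vertex s′ y) ≁)) (fs t)) ⟩
      π b * E n (λ t → literal s′ l t * f t)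
        ≡⟨ cong (π b *_) (trans (E-lit n b (x≢y ∘ proj₁ ∘ vertex-injective s′ s′) f) (cong (π b *_) (E-cong n fs′))) ⟩
      π b * (π b * E n f)
        ≤⟨ ≤-by (π b * D * E n f) (lemma (π b) D (E n f)) (*-nonNeg (*-nonNeg (π-nonNeg b) 0≤D) (E-nonNeg n 0≤f)) ⟩
      joint s s′ l * E n f ∎
      where
      open ≤-Reasoning
      set : Tour n → Tour n
      set = setAdj b (vertex s x) (vertex s y)
      D = δ (index s′ x) (index s x) * δ (index s′ y) (index s y)
      0≤D : 0ℚ ≤ D
      0≤D = *-nonNeg (δ-nonNeg (index s′ x) (index s x)) (δ-nonNeg (index s′ y) (index s y))
      lemma : ∀ q d e → q * (q + d) * e ≡ q * (q * e) + q * d * e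
      lemma = solve-∀ ℚ-ring
      ≁ : ¬ SameEdge (vertex s x) (vertex s y) (vertex s′ x) (vertex s′ y)
      ≁ (inj₁ (e , e′)) = ¬e (sym (proj₂ (vertex-injective s s′ e)) , sym (proj₂ (vertex-injective s s′ e′)))
      -- A reversed coincidence would put the two ends of the literal into the same block.
      ≁ (inj₂ (e , _))  = x≢y (proj₁ (vertex-injective s s′ e))

    E-∏-literal² : ∀ s s′ L → All Loopless L → AllPairs Disjoint L →
      E n (λ t → ∏ (λ l → literal s l t * literal s′ l t) L) ≤ ∏ (joint s s′) L
    E-∏-literal² s s′ [] [] [] = ≤-reflexive (E-const n 1ℚ)
    E-∏-literal² s s′ (l ∷ L) (x≢y ∷ loopless) (l≁ ∷ L≁) = ≤-trans
      (E-literal² s s′ l f (λ t → ∏-nonNeg L (λ l′ → *-nonNeg (literal-nonNeg s l′ t) (literal-nonNeg s′ l′ t))) x≢y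
        (stable s) (stable s′))
      (*-monoˡ-≤ (joint-nonNeg s s′ l) (E-∏-literal² s s′ L loopless L≁))
      where
      f : Tour n → ℚ
      f t = ∏ (λ l → literal s l t * literal s′ l t) L
      stable : ∀ s″ t → f (setAdj (proj₁ l) (vertex s″ (proj₁ (proj₂ l))) (vertex s″ (proj₂ (proj₂ l))) t) ≡ f t
      stable s″ t = begin
        f (set t)
          ≡⟨ ∏-* (λ l → literal s l (set t)) (λ l → literal s′ l (set t)) L ⟨
        ∏ (λ l → literal s l (set t)) L * ∏ (λ l → literal s′ l (set t)) L
          ≡⟨ cong₂ _*_ (∏-literal-setAdj s″ s l L l≁ t) (∏-literal-setAdj s″ s′ l L l≁ t) ⟩
        ∏ (λ l → literal s l t) L * ∏ (λ l → literal s′ l t) L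
          ≡⟨ ∏-* (λ l → literal s l t) (λ l → literal s′ l t) L ⟩
        f t ∎
        where
        open ≡-Reasoning
        set : Tour n → Tour n
        set = setAdj (proj₁ l) (vertex s″ (proj₁ (proj₂ l))) (vertex s″ (proj₂ (proj₂ l)))

    -- A majorant for the overlap of two copies that is a product over the free indices, so that it
    -- can be summed one coordinate at a time.
    agreement : ∀ {k} → Vec (Fin M) k → Vec (Fin M) k → ℚ
    agreement []      []       = 1ℚ
    agreement (i ∷ s) (j ∷ s′) = (p + δ j i) * agreement s s′

    -- Each coordinate contributes the factor `fromℕ M * p + 1ℚ`, which is at most 2 by `Mp≤1`.
    sumVec-agreement : ∀ k s → sumVec M k (agreement s) ≤ (1ℚ + 1ℚ) ^ k
    sumVec-agreement zero    []      = ≤-refl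
    sumVec-agreement (suc k) (i ∷ s) = begin
      sum (λ j → sumVec M k (λ s′ → (p + δ j i) * agreement s s′))
        ≡⟨ sum-cong-≗ (λ j → sumVec-* M k (p + δ j i) (agreement s)) ⟩
      sum (λ j → (p + δ j i) * sumVec M k (agreement s))
        ≤⟨ sum-mono (λ j → *-monoˡ-≤ (+-nonNeg 0≤p (δ-nonNeg j i)) (sumVec-agreement k s)) ⟩
      sum (λ j → (p + δ j i) * (1ℚ + 1ℚ) ^ k)
        ≡⟨ *-distribʳ-sum ((1ℚ + 1ℚ) ^ k) (λ j → p + δ j i) ⟨
      sum (λ j → p + δ j i) * (1ℚ + 1ℚ) ^ k
        ≡⟨ cong (_* (1ℚ + 1ℚ) ^ k) (trans (∑-distrib-+ (λ _ → p) (λ j → δ j i)) (cong₂ _+_ (sum-const M p) (sum-δ i))) ⟩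
      (fromℕ M * p + 1ℚ) * (1ℚ + 1ℚ) ^ k
        ≤⟨ *-monoʳ-≤ (^-nonNeg k (≤ᵇ⇒≤ {0ℚ} {1ℚ + 1ℚ} _)) (+-monoˡ-≤ 1ℚ Mp≤1) ⟩
      (1ℚ + 1ℚ) * (1ℚ + 1ℚ) ^ k ∎
      where open ≤-Reasoning

    -- A triangle has as many edges as vertices, and an edge is shared only if both its ends agree.
    -- Thus the product over edges, where the indices are entangled, is bounded by one over
    -- vertices. If `c` is true, two edge factors become the vertex factors of `a` and `b`; if it is
    -- false, two edge factors drop to `p`.
    triangle-≤ : ∀ a b c → (p + val a * val b) * (p + val b * val c) * (p + val a * val c) ≤
                           (p + val a) * (p + val b) * (p + val c)
    triangle-≤ a b true = ≤-by ((p + val a) * (p + val b) * (1ℚ - val a * val b)) (lemma p (val a) (val b))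
      (*-nonNeg (*-nonNeg (+-nonNeg 0≤p (val-nonNeg a)) (+-nonNeg 0≤p (val-nonNeg b)))
        (0≤q-p (*-mono-≤ (val-nonNeg a) (val≤1 a) (val-nonNeg b) (val≤1 b))))
      where
      lemma : ∀ p a b → (p + a) * (p + b) * (p + 1ℚ) ≡
        (p + a * b) * (p + b * 1ℚ) * (p + a * 1ℚ) + (p + a) * (p + b) * (1ℚ - a * b)
      lemma = solve-∀ ℚ-ring
    triangle-≤ a b false = ≤-by (p * ((1ℚ - p) * (val a * val b) + p * (val a + val b))) (lemma p (val a) (val b))
      (*-nonNeg 0≤p (+-nonNeg (*-nonNeg 0≤1-p (*-nonNeg (val-nonNeg a) (val-nonNeg b)))
        (*-nonNeg 0≤p (+-nonNeg (val-nonNeg a) (val-nonNeg b)))))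
      where
      lemma : ∀ p a b → (p + a) * (p + b) * (p + 0ℚ) ≡
        (p + a * b) * (p + b * 0ℚ) * (p + a * 0ℚ) + p * ((1ℚ - p) * (a * b) + p * (a + b))
      lemma = solve-∀ ℚ-ring

    -- Edges are charged to free vertices: those of the triangle to 0, 4 and 8, and the edges 1 3
    -- and 5 7 to 3 and 7.
    ∏-joint-≤ : ∀ s s′ → ∏ (joint s s′) backs ≤ p ^ 5 * agreement s s′
    ∏-joint-≤ (i ∷ j ∷ k ∷ b ∷ d ∷ []) (i′ ∷ j′ ∷ k′ ∷ b′ ∷ d′ ∷ []) = begin
      -- Vertices 1 and 5 have index `zero` in every copy, so their `δ` evaluates to `1ℚ`.
      p * (p + δi * δj) * (p * (p + δj * δk) * (p * (p + δi * δk) * (p * (p + 1ℚ * δb) * (p * (p + 1ℚ * δd) * 1ℚ))))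
        ≡⟨ lemma p (p + δi * δj) (p + δj * δk) (p + δi * δk) δb δd ⟩
      p ^ 5 * ((p + δi * δj) * (p + δj * δk) * (p + δi * δk) * ((p + δb) * (p + δd)))
        ≤⟨ *-monoˡ-≤ (^-nonNeg 5 0≤p) (*-monoʳ-≤ (*-nonNeg (+-nonNeg 0≤p (δ-nonNeg b′ b)) (+-nonNeg 0≤p (δ-nonNeg d′ d)))
             (triangle-≤ (does (i′ ≟ i)) (does (j′ ≟ j)) (does (k′ ≟ k)))) ⟩
      p ^ 5 * ((p + δi) * (p + δj) * (p + δk) * ((p + δb) * (p + δd)))
        ≡⟨ cong (p ^ 5 *_) (lemma′ (p + δi) (p + δj) (p + δk) (p + δb) (p + δd)) ⟩
      p ^ 5 * ((p + δi) * ((p + δj) * ((p + δk) * ((p + δb) * ((p + δd) * 1ℚ))))) ∎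
      where
      open ≤-Reasoning
      δi = δ i′ i
      δj = δ j′ j
      δk = δ k′ k
      δb = δ b′ b
      δd = δ d′ d
      lemma : ∀ p x y z b d → p * x * (p * y * (p * z * (p * (p + 1ℚ * b) * (p * (p + 1ℚ * d) * 1ℚ)))) ≡
        p * (p * (p * (p * (p * 1ℚ)))) * (x * y * z * ((p + b) * (p + d)))
      lemma = solve-∀ ℚ-ring
      lemma′ : ∀ x y z b d → x * y * z * (b * d) ≡ x * (y * (z * (b * (d * 1ℚ))))
      lemma′ = solve-∀ ℚ-ring

∏-mono-≤ : ∀ {A : Set} {f g : A → ℚ} {P : A → Set} → (∀ x → 0ℚ ≤ f x) → (∀ x → P x → f x ≤ g x) →
  ∀ {xs} → All P xs → ∏ f xs ≤ ∏ g xs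
∏-mono-≤ 0≤f f≤g []                   = ≤-refl
∏-mono-≤ 0≤f f≤g {x ∷ xs} (px ∷ pxs) =
  *-mono-≤ (0≤f x) (f≤g x px) (∏-nonNeg xs 0≤f) (∏-mono-≤ 0≤f f≤g pxs)

sq-nonNeg : ∀ x → 0ℚ ≤ x * x
sq-nonNeg x with ≤-total 0ℚ x
... | inj₁ 0≤x = *-nonNeg 0≤x 0≤x
... | inj₂ x≤0 = subst (0ℚ ≤_) (lemma x) (*-nonNeg 0≤-x 0≤-x)
  where
  0≤-x : 0ℚ ≤ - x
  0≤-x = neg-antimono-≤ x≤0
  lemma : ∀ x → - x * - x ≡ x * x
  lemma = solve-∀ ℚ-ring

-- Kept abstract so that the type checker does not evaluate these rationals.
abstract
  η κ : ℚ
  η = ½ ^ 19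
  κ = ½ ^ 5

  0<η : 0ℚ < η
  0<η = ^-pos 19 (positive⁻¹ ½)

  0<κ : 0ℚ < κ
  0<κ = ^-pos 5 (positive⁻¹ ½)

  κ*2⁵ : κ * (1ℚ + 1ℚ) ^ 5 ≡ 1ℚ
  κ*2⁵ = refl

  η≡∏½ : η ≡ ∏ (λ _ → ½) forwards
  η≡∏½ = refl

-- Upper bound by the second moment method

module UpperBound (M′ n : ℕ) (9M≤n : 9 ℕ.* suc M′ ℕ.≤ n)
                  (p : ℚ) (0≤p : 0ℚ ≤ p) (p≤½ : p ≤ ½)
                  (β : ℚ) (0≤β : 0ℚ ≤ β) (β≤Mp : β ≤ fromℕ (suc M′) * p) (Mp≤1 : fromℕ (suc M′) * p ≤ 1ℚ) where

  p≤1 : p ≤ 1ℚ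
  p≤1 = ≤-trans p≤½ (≤ᵇ⇒≤ {½} {1ℚ} _)

  open Copies M′ n 9M≤n
  open Expectation p 0≤p p≤1
  open Edges p 0≤p p≤1
  open Moments p 0≤p p≤1 Mp≤1

  copies : Tour n → ℚ
  copies t = sumVec M 5 (λ s → copy s t)

  -- `μ` is the number of candidate copies times the probability of five given backward arcs; `T`
  -- bounds the cost of overlaps in the second moment.
  μ T : ℚ
  μ = fromℕ M ^ 5 * p ^ 5
  T = (1ℚ + 1ℚ) ^ 5

  E-sumVec : ∀ k (f : Vec (Fin M) k → Tour n → ℚ) →
    E n (λ t → sumVec M k (λ s → f s t)) ≡ sumVec M k (λ s → E n (f s))
  E-sumVec zero    f = refl
  E-sumVec (suc k) f = trans (E-sum n (λ i t → sumVec M k (λ s → f (i ∷ s) t)))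
    (sum-cong-≗ λ i → E-sumVec k (λ s → f (i ∷ s)))

  ½≤1-p : ½ ≤ 1ℚ - p
  ½≤1-p = ≤-by (½ - p) (lemma p) (0≤q-p p≤½)
    where
    lemma : ∀ p → 1ℚ - p ≡ ½ + (½ - p)
    lemma = solve-∀ ℚ-ring

  -- The five backward arcs give `p ^ 5`, and each of the 19 forward literals has probability at
  -- least ½ by `p≤½`.
  E-copy-≥ : ∀ s → p ^ 5 * η ≤ E n (copy s)
  E-copy-≥ s = begin
    p ^ 5 * η                                          ≡⟨ cong (p ^ 5 *_) η≡∏½ ⟩
    p ^ 5 * ∏ (λ _ → ½) forwards                       ≤⟨ *-monoˡ-≤ (^-nonNeg 5 0≤p) (∏-mono-≤ {f = λ _ → ½} (λ _ → ≤ᵇ⇒≤ {0ℚ} {½} _) half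
                                                            (from-yes (All.all? (λ (b , _) → b Bool.≟ false) forwards))) ⟩
    p ^ 5 * ∏ (π ∘ proj₁) forwards                     ≡⟨⟩
    ∏ (π ∘ proj₁) backs * ∏ (π ∘ proj₁) forwards       ≡⟨ ∏-++ (π ∘ proj₁) backs forwards ⟨
    ∏ (π ∘ proj₁) pattern-literals                     ≡⟨ E-∏-literal s pattern-literals pattern-loopless pattern-disjoint ⟨
    E n (copy s)                                       ∎
    where
    open ≤-Reasoning
    half : ∀ l → proj₁ l ≡ false → ½ ≤ π (proj₁ l)
    half (false , _) refl = ½≤1-p

  E-copies-≥ : μ * η ≤ E n copies
  E-copies-≥ = begin
    μ * η                                 ≡⟨ *-assoc (fromℕ M ^ 5) (p ^ 5) η ⟩
    fromℕ M ^ 5 * (p ^ 5 * η)             ≡⟨ sumVec-const M 5 (p ^ 5 * η) ⟨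
    sumVec M 5 (λ _ → p ^ 5 * η)          ≤⟨ sumVec-mono M 5 E-copy-≥ ⟩
    sumVec M 5 (λ s → E n (copy s))       ≡⟨ E-sumVec 5 copy ⟨
    E n copies                            ∎
    where open ≤-Reasoning

  backs-loopless : All Loopless backs
  backs-loopless = from-yes (All.all? (λ (_ , x , y) → ¬? (x ≟ y)) backs)

  backs-disjoint : AllPairs Disjoint backs
  backs-disjoint = from-yes (AllPairs.allPairs? disjoint? backs)

  E-copy² : ∀ s s′ → E n (λ t → copy s t * copy s′ t) ≤ p ^ 5 * agreement s s′
  E-copy² s s′ = begin
    E n (λ t → copy s t * copy s′ t)
      ≤⟨ E-mono n (λ t → *-mono-≤ (copy-nonNeg s t) (copy≤backs s t) (copy-nonNeg s′ t) (copy≤backs s′ t)) ⟩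
    E n (λ t → ∏ (λ l → literal s l t) backs * ∏ (λ l → literal s′ l t) backs)
      ≡⟨ E-cong n (λ t → ∏-* (λ l → literal s l t) (λ l → literal s′ l t) backs) ⟩
    E n (λ t → ∏ (λ l → literal s l t * literal s′ l t) backs)
      ≤⟨ E-∏-literal² s s′ backs backs-loopless backs-disjoint ⟩
    ∏ (joint s s′) backs
      ≤⟨ ∏-joint-≤ s s′ ⟩
    p ^ 5 * agreement s s′ ∎
    where open ≤-Reasoning

  -- The square is a sum over ordered pairs of copies. For a fixed first copy, `agreement` summed
  -- over the second one is at most `T`.
  E-copies² : E n (λ t → copies t * copies t) ≤ μ * T
  E-copies² = begin
    E n (λ t → copies t * copies t)
      ≡⟨ E-cong n (λ t → trans (*-comm (copies t) (copies t)) (trans (sym (sumVec-* M 5 (copies t) (λ s → copy s t)))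
           (sumVec-cong M 5 λ s → trans (*-comm (copies t) (copy s t)) (sym (sumVec-* M 5 (copy s t) (λ s′ → copy s′ t)))))) ⟩
    E n (λ t → sumVec M 5 (λ s → sumVec M 5 (λ s′ → copy s t * copy s′ t)))
      ≡⟨ trans (E-sumVec 5 (λ s t → sumVec M 5 (λ s′ → copy s t * copy s′ t)))
           (sumVec-cong M 5 λ s → E-sumVec 5 (λ s′ t → copy s t * copy s′ t)) ⟩
    sumVec M 5 (λ s → sumVec M 5 (λ s′ → E n (λ t → copy s t * copy s′ t)))
      ≤⟨ sumVec-mono M 5 (λ s → sumVec-mono M 5 (λ s′ → E-copy² s s′)) ⟩
    sumVec M 5 (λ s → sumVec M 5 (λ s′ → p ^ 5 * agreement s s′))
      ≡⟨ sumVec-cong M 5 (λ s → sumVec-* M 5 (p ^ 5) (agreement s)) ⟩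
    sumVec M 5 (λ s → p ^ 5 * sumVec M 5 (agreement s))
      ≤⟨ sumVec-mono M 5 (λ s → *-monoˡ-≤ (^-nonNeg 5 0≤p) (sumVec-agreement 5 s)) ⟩
    sumVec M 5 (λ s → p ^ 5 * T)
      ≡⟨ trans (sumVec-const M 5 (p ^ 5 * T)) (sym (*-assoc (fromℕ M ^ 5) (p ^ 5) T)) ⟩
    μ * T ∎
    where open ≤-Reasoning

  β^5≤μ : β ^ 5 ≤ μ
  β^5≤μ = ≤-trans (^-mono-≤ 5 0≤β β≤Mp) (≤-reflexive (lemma (fromℕ M) p))
    where
    lemma : ∀ a b → a * b * (a * b * (a * b * (a * b * (a * b * 1ℚ)))) ≡ a * (a * (a * (a * (a * 1ℚ)))) * (b * (b * (b * (b * (b * 1ℚ)))))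
    lemma = solve-∀ ℚ-ring

  -- The indicator of X = 0 is at most (1 - θX)², where θ approximates E[X] / E[X²].
  Pr-≤ : (d : ∀ t → Dec (χ≤ {n} 2 t)) → Pr n p (χ≤ 2) d ≤ 1ℚ - η * η * κ * β ^ 5
  Pr-≤ d = ≤-by (1ℚ - c * β ^ 5 - P) (split (c * β ^ 5) P) (0≤q-p (≤-trans main weaken))
    where
    P = Pr n p (χ≤ 2) d
    -- As `κ` is the inverse of `T`, this is the lower bound `μ * η` for the first moment divided by
    -- the upper bound `μ * T` for the second one, the minimiser of the resulting quadratic in θ.
    θ = η * κ
    c = η * η * κ
    0≤η : 0ℚ ≤ η
    0≤η = <⇒≤ 0<η
    0≤κ : 0ℚ ≤ κ
    0≤κ = <⇒≤ 0<κ
    0≤θ : 0ℚ ≤ θ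
    0≤θ = *-nonNeg 0≤η 0≤κ
    split : ∀ a b → 1ℚ - a ≡ b + (1ℚ - a - b)
    split = solve-∀ ℚ-ring

    pointwise : ∀ t → ⟦ d t ⟧ + (θ + θ) * copies t ≤ 1ℚ + θ * θ * (copies t * copies t)
    pointwise t = ⟦⟧-elim (d t) (λ q → q + (θ + θ) * copies t ≤ 1ℚ + θ * θ * (copies t * copies t))
      (λ colorable → ≤-reflexive (trans (cong (λ x → 1ℚ + (θ + θ) * x) (none colorable))
        (trans (vanish θ) (cong (λ x → 1ℚ + θ * θ * (x * x)) (sym (none colorable))))))
      (λ _ → ≤-by ((1ℚ - θ * copies t) * (1ℚ - θ * copies t)) (square θ (copies t)) (sq-nonNeg (1ℚ - θ * copies t)))
      where
      none : Colorable 2 t → copies t ≡ 0ℚ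
      none colorable = trans (sumVec-cong M 5 (Colorable⇒no-copy t colorable))
        (trans (sumVec-const M 5 0ℚ) (*-zeroʳ (fromℕ M ^ 5)))
      vanish : ∀ θ → 1ℚ + (θ + θ) * 0ℚ ≡ 1ℚ + θ * θ * (0ℚ * 0ℚ)
      vanish = solve-∀ ℚ-ring
      square : ∀ θ x → 1ℚ + θ * θ * (x * x) ≡ 0ℚ + (θ + θ) * x + (1ℚ - θ * x) * (1ℚ - θ * x)
      square = solve-∀ ℚ-ring

    main : P ≤ 1ℚ + θ * θ * (μ * T) - (θ + θ) * (μ * η)
    main = ≤-by (1ℚ + θ * θ * (μ * T) - (P + (θ + θ) * (μ * η))) (move P (θ * θ * (μ * T)) ((θ + θ) * (μ * η))) (0≤q-p expected)
      where
      open ≤-Reasoning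
      move : ∀ P a b → 1ℚ + a - b ≡ P + (1ℚ + a - (P + b))
      move = solve-∀ ℚ-ring
      expected : P + (θ + θ) * (μ * η) ≤ 1ℚ + θ * θ * (μ * T)
      expected = begin
        P + (θ + θ) * (μ * η)
          ≤⟨ +-monoʳ-≤ P (*-monoˡ-≤ (+-nonNeg 0≤θ 0≤θ) E-copies-≥) ⟩
        P + (θ + θ) * E n copies
          ≡⟨ cong₂ _+_ (Pr≡E n (χ≤ 2) d) (sym (E-* n (θ + θ) copies)) ⟩
        E n (λ t → ⟦ d t ⟧) + E n (λ t → (θ + θ) * copies t)
          ≡⟨ E-+ n (λ t → ⟦ d t ⟧) (λ t → (θ + θ) * copies t) ⟨
        E n (λ t → ⟦ d t ⟧ + (θ + θ) * copies t)
          ≤⟨ E-mono n pointwise ⟩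
        E n (λ t → 1ℚ + θ * θ * (copies t * copies t))
          ≡⟨ trans (E-+ n (λ _ → 1ℚ) (λ t → θ * θ * (copies t * copies t)))
               (cong₂ _+_ (E-const n 1ℚ) (E-* n (θ * θ) (λ t → copies t * copies t))) ⟩
        1ℚ + θ * θ * E n (λ t → copies t * copies t)
          ≤⟨ +-monoʳ-≤ 1ℚ (*-monoˡ-≤ (*-nonNeg 0≤θ 0≤θ) E-copies²) ⟩
        1ℚ + θ * θ * (μ * T) ∎

    weaken : 1ℚ + θ * θ * (μ * T) - (θ + θ) * (μ * η) ≤ 1ℚ - c * β ^ 5
    -- Because `κ * T` is 1, the quadratic term equals `c * μ` and the linear term is twice that,
    -- which leaves 1 - c μ.
    weaken = ≤-by (c * (μ - β ^ 5)) (lemma η κ T μ (β ^ 5) κ*2⁵) (*-nonNeg (*-nonNeg (*-nonNeg 0≤η 0≤η) 0≤κ) (0≤q-p β^5≤μ))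
      where
      expand : ∀ η κ T μ b → 1ℚ - η * η * κ * b ≡
        1ℚ + η * κ * (η * κ) * (μ * T) - (η * κ + η * κ) * (μ * η) + η * η * κ * (μ - b) + η * η * κ * μ * (1ℚ - κ * T)
      expand = solve-∀ ℚ-ring
      lemma : ∀ η κ T μ b → κ * T ≡ 1ℚ → 1ℚ - η * η * κ * b ≡
        1ℚ + η * κ * (η * κ) * (μ * T) - (η * κ + η * κ) * (μ * η) + η * η * κ * (μ - b)
      lemma η κ T μ b κT≡1 = trans (expand η κ T μ b) (trans
        (cong (λ x → Z + η * η * κ * μ * (1ℚ - x)) κT≡1)
        (trans (cong (Z +_) (*-zeroʳ (η * η * κ * μ))) (+-identityʳ Z)))
        where
        Z = 1ℚ + η * κ * (η * κ) * (μ * T) - (η * κ + η * κ) * (μ * η) + η * η * κ * (μ - b)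

-- Choice of constants

inv-pos : ∀ n → .{{_ : ℕ.NonZero n}} → 0ℚ < inv n
inv-pos (suc n) = positive⁻¹ (inv (suc n)) {{normalize-pos 1 (suc n)}}

inv-≤ : ∀ a M n → .{{_ : ℕ.NonZero a}} → .{{_ : ℕ.NonZero n}} → n ℕ.≤ a ℕ.* M → inv a ≤ fromℕ M * inv n
inv-≤ a M n n≤aM = begin
  inv a                                        ≡⟨ *-identityʳ (inv a) ⟨
  inv a * 1ℚ                                   ≡⟨ cong (inv a *_) (fromℕ*inv n) ⟨
  inv a * (fromℕ n * inv n)                    ≤⟨ *-monoˡ-≤ (inv-nonNeg a) (*-monoʳ-≤ (inv-nonNeg n) (fromℕ-mono-≤ n≤aM)) ⟩
  inv a * (fromℕ (a ℕ.* M) * inv n)            ≡⟨ cong (λ b → inv a * (b * inv n)) (fromℕ-* a M) ⟩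
  inv a * (fromℕ a * fromℕ M * inv n)          ≡⟨ lemma (inv a) (fromℕ a) (fromℕ M) (inv n) ⟩
  fromℕ a * inv a * (fromℕ M * inv n)          ≡⟨ cong (_* (fromℕ M * inv n)) (fromℕ*inv a) ⟩
  1ℚ * (fromℕ M * inv n)                       ≡⟨ *-identityˡ (fromℕ M * inv n) ⟩
  fromℕ M * inv n                              ∎
  where
  open ≤-Reasoning
  lemma : ∀ a b c d → a * (b * c * d) ≡ b * a * (c * d)
  lemma = solve-∀ ℚ-ring

-- The block length is the integer part of n / 9. It is positive, so the remainder is at most
-- another `9 ℕ.* M`, which explains the 18.
blocks : ∀ n → 9 ℕ.≤ n → ∃ λ M′ → 9 ℕ.* suc M′ ℕ.≤ n × n ℕ.≤ 18 ℕ.* suc M′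
blocks n 9≤n = ℕ.pred M , subst (λ k → 9 ℕ.* k ℕ.≤ n × n ℕ.≤ 18 ℕ.* k) (sym (ℕ.suc-pred M)) (lower , upper)
  where
  M = n ℕ./ 9
  instance
    M≢0 : ℕ.NonZero M
    M≢0 = ℕ.>-nonZero (ℕ.m≥n⇒m/n>0 9≤n)
  lower : 9 ℕ.* M ℕ.≤ n
  lower = ℕ.≤-trans (ℕ.≤-reflexive (ℕ.*-comm 9 M)) (ℕ.m/n*n≤m n 9)
  double : ∀ M → 9 ℕ.* M ℕ.+ M ℕ.* 9 ≡ 18 ℕ.* M
  double = ℕ-solve-∀
  upper : n ℕ.≤ 18 ℕ.* M
  upper = ℕ.≤-trans (ℕ.≤-reflexive (ℕ.m≡m%n+[m/n]*n n 9)) (ℕ.≤-trans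
    (ℕ.+-monoˡ-≤ (M ℕ.* 9) (ℕ.≤-trans (ℕ.<⇒≤ (ℕ.m%n<n n 9)) (ℕ.m≤m*n 9 M)))
    (ℕ.≤-reflexive (double M)))

halves : ∀ x → ½ * x + ½ * x ≡ x
halves x = trans (sym (*-distribʳ-+ x ½ ½)) (*-identityˡ x)

upper-bound : ∀ h → 0ℚ < h → h + h < 1ℚ → ∀ q → 1ℚ ≤ fromℕ q * h →
  ∀ n {{_ : ℕ.NonZero q}} {{_ : ℕ.NonZero n}} → 2 ℕ.* q ℕ.≤ n → (∃ λ M′ → 9 ℕ.* suc M′ ℕ.≤ n × n ℕ.≤ 18 ℕ.* suc M′) → (d : ∀ t → Dec (χ≤ {n} 2 t)) →
  Pr n ((1ℚ - (h + h)) * inv n) (χ≤ 2) d ≤ 1ℚ - η * η * κ * ((1ℚ - (h + h)) * inv 18) ^ 5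
upper-bound h 0<h 2h<1 q 1≤qh n 2q≤n (M′ , 9M≤n , n≤18M) d =
  UpperBound.Pr-≤ M′ n 9M≤n p 0≤p (≤-trans p≤i (≤-trans i≤h h≤½))
        ((1ℚ - (h + h)) * inv 18) (*-nonNeg 0≤1-2h (inv-nonNeg 18)) β≤Mp Mp≤1 d
  where
  open LowerBound h 0<h 2h<1 q 1≤qh n 2q≤n
  h≤½ : h ≤ ½
  h≤½ = ≤-trans (≤-reflexive (trans (sym (halves h)) (sym (*-distribˡ-+ ½ h h))))
    (*-monoˡ-≤ {½} {b = 1ℚ} (≤ᵇ⇒≤ {0ℚ} {½} _) (<⇒≤ 2h<1))
  -- The factor `inv 18` is the lower bound on M / n supplied by `n≤18M`.
  β≤Mp : (1ℚ - (h + h)) * inv 18 ≤ fromℕ (suc M′) * p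
  β≤Mp = ≤-trans (*-monoˡ-≤ 0≤1-2h (inv-≤ 18 (suc M′) n n≤18M))
    (≤-reflexive (lemma (1ℚ - (h + h)) (fromℕ (suc M′)) (inv n)))
    where
    lemma : ∀ a b c → a * (b * c) ≡ b * (a * c)
    lemma = solve-∀ ℚ-ring
  Mp≤1 : fromℕ (suc M′) * p ≤ 1ℚ
  Mp≤1 = ≤-trans (*-monoˡ-≤ (fromℕ-nonNeg (suc M′)) p≤i) (m*i≤1 (ℕ.≤-trans (ℕ.m≤n*m (suc M′) 9) 9M≤n))

-- The conclusion as a predicate of ε, so that a proof for `h + h` with `h` half of ε can be
-- transported to ε itself.
Bounded : ℚ → Set
Bounded ε = Σ ℚ λ c → Σ ℚ λ c′ → 0ℚ < c × 0ℚ < c′ ×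
    Σ ℕ λ N → ∀ n → N ℕ.≤ n →
    (d : ∀ t → Dec (χ≤ {n} 2 t)) →
    c ≤ Pr n ((1ℚ - ε) * inv n) (χ≤ 2) d
    × Pr n ((1ℚ - ε) * inv n) (χ≤ 2) d ≤ 1ℚ - c′

bounded : ∀ h → 0ℚ < h → h + h < 1ℚ → (∃ λ q₀ → 1ℚ ≤ fromℕ q₀ * h) → Bounded (h + h)
bounded h 0<h 2h<1 (q₀ , 1≤q₀h) =
      ½ ^ (4 ℕ.* q) , η * η * κ * β ^ 5 ,
      ^-pos (4 ℕ.* q) (positive⁻¹ ½) ,
      *-pos (*-pos (*-pos 0<η 0<η) 0<κ) (^-pos 5 0<β) ,
      -- The lower bound needs n to be at least 2q, and the division into nine nonempty blocks needs
      -- it to be at least 9.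
      2 ℕ.* q ℕ.+ 9 , bounds
  where
  -- The successor makes `q` visibly nonzero, and enlarging the witness preserves the inequality
  -- with `h`.
  q = suc q₀
  β = (1ℚ - (h + h)) * inv 18
  0<β : 0ℚ < β
  0<β = *-pos (subst (_< 1ℚ - (h + h)) (+-inverseʳ (h + h)) (+-monoˡ-< (- (h + h)) 2h<1)) (inv-pos 18)
  1≤qh : 1ℚ ≤ fromℕ q * h
  1≤qh = ≤-trans 1≤q₀h (*-monoʳ-≤ (<⇒≤ 0<h) (fromℕ-mono-≤ (ℕ.n≤1+n q₀)))

  bounds : ∀ n → 2 ℕ.* q ℕ.+ 9 ℕ.≤ n → (d : ∀ t → Dec (χ≤ {n} 2 t)) →
    ½ ^ (4 ℕ.* q) ≤ Pr n ((1ℚ - (h + h)) * inv n) (χ≤ 2) d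
    × Pr n ((1ℚ - (h + h)) * inv n) (χ≤ 2) d ≤ 1ℚ - η * η * κ * β ^ 5
  bounds n N≤n d = LowerBound.Pr-≥ h 0<h 2h<1 q 1≤qh n 2q≤n d , upper-bound h 0<h 2h<1 q 1≤qh n 2q≤n (blocks n 9≤n) d
    where
    2q≤n : 2 ℕ.* q ℕ.≤ n
    2q≤n = ℕ.≤-trans (ℕ.m≤m+n (2 ℕ.* q) 9) N≤n
    9≤n : 9 ℕ.≤ n
    9≤n = ℕ.≤-trans (ℕ.m≤n+m 9 (2 ℕ.* q)) N≤n
    instance
      n≢0 : ℕ.NonZero n
      n≢0 = ℕ.>-nonZero (ℕ.≤-trans (ℕ.s≤s ℕ.z≤n) 9≤n)

theorem1p5 : (ε : ℚ) → 0ℚ < ε → ε < 1ℚ →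
    Σ ℚ λ c → Σ ℚ λ c′ → 0ℚ < c × 0ℚ < c′ ×
    Σ ℕ λ N → ∀ n → N ℕ.≤ n →
    (d : ∀ t → Dec (χ≤ {n} 2 t)) →
    c ≤ Pr n ((1ℚ - ε) * inv n) (χ≤ 2) d
    × Pr n ((1ℚ - ε) * inv n) (χ≤ 2) d ≤ 1ℚ - c′
theorem1p5 ε 0<ε ε<1 = subst Bounded (halves ε)
  (bounded (½ * ε) 0<½ε (subst (_< 1ℚ) (sym (halves ε)) ε<1) (archimedean (½ * ε) 0<½ε))
  where
  0<½ε : 0ℚ < ½ * ε
  0<½ε = *-pos (positive⁻¹ ½) 0<ε
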